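{- Let $F$ be a Ferrers board whose longest row and longest column have the same length, and let $S$ be an $F$-sequence. Then: (a) there exists $P \in S_F(231)$ such that $S(P,F) = S$ if and only if $(F,S)$ satisfies the 231-conditions; (b) there exists $P \in S_F(312)$ such that $S(P,F) = S$ if and only if $(F,S)$ satisfies the 312-conditions.
   Context: Let $\mathcal{A}$ be an $m\times m$ array of unit squares in the $xy$-plane with its bottom left corner at the origin. The corners of squares are called vertices. For a vertex $V=(a,b)$, $R(V)$ denotes the rectangular array of squares bounded by the lines $x=0$, $x=a$, $y=0$, $y=b$ (empty if $a=0$ or $b=0$). A Ferrers board is a subset $F$ of $\mathcal{A}$ (for some $m$) such that $R(V)\subseteq F$ for each vertex $V$ of $F$ (a vertex of $F$ is a corner of a square of $F$). So $F$ is left- and bottom-justified. The right/up border of $F$ is the border of $F$ excluding the vertical left-hand side and the horizontal bottom side: it is the lattice path of unit rightward and downward steps along the boundary of $F$ from the top left corner $(0,h)$ of $F$ to the bottom right corner $(w,0)$, where $h$ is the length of the longest column and $w$ that of the longest row; both endpoints are vertices of the right/up border. A rook placement on $F$ is a subset of the squares of $F$ (the squares containing "markers") with at most one square in each row and at most one in each column of $F$; a full rook placement has exactly one marker in each row and each column of $F$. A rook placement $P$ on $F$ avoids a pattern $\tau$ if for every vertex $V$ on the right/up border of $F$ the permutation order-isomorphic to the restriction of $P$ to $R(V)$ (markers read left to right, by height) avoids $\tau$ in the usual sense (has no subsequence order-isomorphic to $\tau$). $S_F(\tau)$ is the set of all full rook placements on $F$ that avoid $\tau$. For a rook placement $P$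 on $F$ and a vertex $V$ of $F$, $S(P,V)$ is the maximal length of an increasing sequence of markers of $P$ in $R(V)$ (each successive marker strictly to the right of and strictly above the previous one); it is $0$ if $R(V)$ contains no marker. For a full rook placement $P$, $S(P,F)$ denotes the sequence of values $S(P,V)$ for all vertices $V$ on the right/up border of $F$, in order, starting with the top left corner of $F$. An $F$-sequence $S$ is a sequence of nonnegative integers $S(V)$ assigned to the vertices $V$ on the right/up border of $F$, in order, starting with the vertex at the top left corner. "Directly to the left of" and "directly below" mean at distance one unit to the left, respectively below. The 231-conditions for $(F,S)$ are: (i) (monotonicity conditions) if $V_1, V_2$ are vertices on the right/up border and $V_1$ is either directly to the left of $V_2$ or directly below $V_2$, then $S(V_1)\le S(V_2)\le S(V_1)+1$; (ii) (0-conditions) the first and last values of $S$ are $0$, and there do not exist consecutive vertices $V_1,V_2$ on the right/up border with $S(V_1)=0=S(V_2)$; (iii) (diagonal condition) if $V_1$ and $V_2$ are vertices on the right/up border that are at the left and right ends, respectively, of a diagonal (line segment) of slope $-1$ lying entirely within $F$, then $S(V_1)\le S(V_2)$. The 312-conditions for $(F,S)$ are the same as the 231-conditions, except that the inequality in (iii) is reversed: $S(V_1)\ge S(V_2)$. -}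

module Defs where

open import Data.Bool.Base using (Bool; T; if_then_else_)
open import Data.Fin.Base as Fin using (Fin; zero; suc; inject₁)
open import Data.List.Base as List
  using (List; []; _∷_; length; map; filter; filterᵇ; concatMap; upTo; foldr)
open import Data.List.Relation.Binary.Sublist.Propositional using (_⊆_)
open import Data.List.Relation.Unary.All using (All)
open import Data.List.Relation.Unary.Linked using (Linked)
open import Data.Nat.Base using (ℕ; zero; suc; _+_; _≤_; _<_; _≥_; _⊔_)
open import Data.Nat.Properties using (_≤?_)
open import Data.Product using (Σ; ∃!; ∃-syntax; _×_; _,_)
open import Data.Sum.Base using (_⊎_)
open import Data.Vec.Base as Vec using (Vec; lookup)
open import Function.Bundles using (_⇔_)
open import Relation.Binary.Core using (Rel)
open import Relation.Binary.PropositionalEquality.Core using (_≡_)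
open import Relation.Nullary.Negation.Core using (¬_)
open import Level using (0ℓ)

-- The square (i , j) is [i, i+1] × [j, j+1]; the vertex (a , b) is the
-- lattice point x = a, y = b.

Square : Set
Square = ℕ × ℕ

Vertex : Set
Vertex = ℕ × ℕ

Squares : Set
Squares = Square → Bool

infix 4 _∈_ _∈R_

_∈_ : Square → Squares → Set
s ∈ X = T (X s)

_∈R_ : Square → Vertex → Set
(i , j) ∈R (a , b) = i < a × j < b

data Corner : Square → Vertex → Set where
  bottomLeft  : ∀ {i j} → Corner (i , j) (i , j)
  bottomRight : ∀ {i j} → Corner (i , j) (suc i , j)
  topLeft     : ∀ {i j} → Corner (i , j) (i , suc j)
  topRight    : ∀ {i j} → Corner (i , j) (suc i , suc j)

IsVertexOf : Vertex → Squares → Set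
IsVertexOf V X = ∃[ s ] s ∈ X × Corner s V

record FerrersBoard : Set where
  field
    m       : ℕ
    squares : Squares
    inArray : ∀ s → s ∈ squares → s ∈R (m , m)
    closed  : ∀ V → IsVertexOf V squares → ∀ s → s ∈R V → s ∈ squares

  columnLength : ℕ → ℕ
  columnLength i = length (filterᵇ (λ j → squares (i , j)) (upTo m))

  rowLength : ℕ → ℕ
  rowLength j = length (filterᵇ (λ i → squares (i , j)) (upTo m))

  longestColumn : ℕ
  longestColumn = foldr _⊔_ 0 (map columnLength (upTo m))

  longestRow : ℕ
  longestRow = foldr _⊔_ 0 (map rowLength (upTo m))

  -- Walking along the right/up border with F always on the lower side:
  -- from (a , b+1) go right when the square below and to the right of the
  -- vertex, namely (a , b), is in F, and otherwise go down.  The last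
  -- vertex has height 0, so the first clause is never used on the border.

  step : Vertex → Vertex
  step (a , zero)  = a , zero
  step (a , suc b) = if squares (a , b) then (suc a , suc b) else (a , b)

  -- With w = longestRow and h = longestColumn, the path from (0 , h) to
  -- (w , 0) has w + h steps.

  borderSteps : ℕ
  borderSteps = longestRow + longestColumn

  border : Vec Vertex (suc borderSteps)
  border = Vec.iterate step (0 , longestColumn) (suc borderSteps)

open FerrersBoard public

FSequence : FerrersBoard → Set
FSequence F = Vec ℕ (suc (borderSteps F))

record RookPlacement (F : FerrersBoard) : Set where
  field
    markers   : Squares
    onBoard   : ∀ s → s ∈ markers → s ∈ squares F
    colAtMost : ∀ {i j j′} → (i , j) ∈ markers → (i , j′) ∈ markers → j ≡ j′
    rowAtMost : ∀ {i i′ j} → (i , j) ∈ markers → (i′ , j) ∈ markers → i ≡ i′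

open RookPlacement public

-- The columns (rows) of F are those containing a square of F.

record IsFull {F : FerrersBoard} (P : RookPlacement F) : Set where
  field
    eachColumn : ∀ i → (∃[ j ] (i , j) ∈ squares F) →
                 ∃! _≡_ λ j → (i , j) ∈ markers P
    eachRow    : ∀ j → (∃[ i ] (i , j) ∈ squares F) →
                 ∃! _≡_ λ i → (i , j) ∈ markers P

OrderIsomorphic : List ℕ → List ℕ → Set
OrderIsomorphic xs ys = Σ (length xs ≡ length ys) λ eq →
  ∀ i j → (List.lookup xs i < List.lookup xs j) ⇔
          (List.lookup ys (Fin.cast eq i) < List.lookup ys (Fin.cast eq j))

_Contains_ : List ℕ → List ℕ → Set
σ Contains τ = ∃[ ρ ] ρ ⊆ σ × OrderIsomorphic ρ τ

-- The heights of the markers in R(V), read from left to right.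

restriction : ∀ {F} → RookPlacement F → Vertex → List ℕ
restriction P (a , b) =
  concatMap (λ i → filterᵇ (λ j → markers P (i , j)) (upTo b)) (upTo a)

-- For a word with distinct entries, the order-isomorphic permutation of
-- 1 , … , n: each entry is replaced by its rank.

standardize : List ℕ → List ℕ
standardize xs = map (λ x → length (filter (_≤? x) xs)) xs

Avoids : ∀ {F} → RookPlacement F → List ℕ → Set
Avoids {F} P τ =
  ∀ k → ¬ (standardize (restriction P (lookup (border F) k)) Contains τ)

_∈S[_] : ∀ {F} → RookPlacement F → List ℕ → Set
P ∈S[ τ ] = IsFull P × Avoids P τ

τ231 τ312 : List ℕ
τ231 = 2 ∷ 3 ∷ 1 ∷ []
τ312 = 3 ∷ 1 ∷ 2 ∷ []

_↗_ : Rel Square 0ℓ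
(i , j) ↗ (i′ , j′) = i < i′ × j < j′

IsIncreasing : ∀ {F} → RookPlacement F → Vertex → List Square → Set
IsIncreasing P V ms = All (λ s → s ∈ markers P × s ∈R V) ms × Linked _↗_ ms

-- S(P,V) = n.

S⟨_,_⟩≡_ : ∀ {F} → RookPlacement F → Vertex → ℕ → Set
S⟨ P , V ⟩≡ n =
  (∃[ ms ] IsIncreasing P V ms × length ms ≡ n) ×
  (∀ ms → IsIncreasing P V ms → length ms ≤ n)

-- S(P,F) = S.

HasSequence : ∀ {F} → RookPlacement F → FSequence F → Set
HasSequence {F} P S = ∀ k → S⟨ P , lookup (border F) k ⟩≡ lookup S k

DirectlyLeftOf : Rel Vertex 0ℓ
DirectlyLeftOf (a , b) V = V ≡ (suc a , b)

DirectlyBelow : Rel Vertex 0ℓ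
DirectlyBelow (a , b) V = V ≡ (a , suc b)

-- V₁ = (a , c+d) and V₂ = (a+d , c) are the left and right ends of a
-- segment of slope -1.  The segment consists of the falling diagonals of
-- the d squares (a+t , c+u) with t + u = d - 1, so it lies within F
-- exactly when these squares belong to F.

DiagonalWithin : FerrersBoard → Rel Vertex 0ℓ
DiagonalWithin F (a , b) (a′ , c) = ∃[ d ]
  b ≡ c + d × a′ ≡ a + d ×
  (∀ t u → suc (t + u) ≡ d → (a + t , c + u) ∈ squares F)

module _ (F : FerrersBoard) (S : FSequence F) where

  Monotonicity : Set
  Monotonicity = ∀ p q →
    let V₁ = lookup (border F) p ; V₂ = lookup (border F) q in
    DirectlyLeftOf V₁ V₂ ⊎ DirectlyBelow V₁ V₂ →
    lookup S p ≤ lookup S q × lookup S q ≤ lookup S p + 1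

  ZeroConditions : Set
  ZeroConditions =
    Vec.head S ≡ 0 × Vec.last S ≡ 0 ×
    ¬ (∃[ k ] lookup S (inject₁ k) ≡ 0 × lookup S (suc k) ≡ 0)

  Diagonal : Rel ℕ 0ℓ → Set
  Diagonal _∼_ = ∀ p q →
    DiagonalWithin F (lookup (border F) p) (lookup (border F) q) →
    lookup S p ∼ lookup S q

  Conditions231 : Set
  Conditions231 = Monotonicity × ZeroConditions × Diagonal _≤_

  Conditions312 : Set
  Conditions312 = Monotonicity × ZeroConditions × Diagonal _≥_

{-# OPTIONS --safe #-}
module Submission where

open import Defs
open import Data.Bool.Base using (Bool; true; false; T)
open import Data.Bool.Properties using (T?)
open import Data.Fin.Base as Fin using (Fin; zero; suc; toℕ; fromℕ<; fromℕ; inject₁)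
open import Data.Fin.Properties using (pigeonhole; toℕ-fromℕ<; toℕ-injective; toℕ<n; toℕ-inject₁; toℕ-fromℕ)
open import Data.List.Base using (List; []; _∷_; _++_; length; map; filter; filterᵇ; concatMap; upTo; applyUpTo; foldr)
open import Data.List.Properties using (filter-accept; filter-reject; filter-none; filter-all; filter-++)
open import Data.List.Membership.Propositional using () renaming (_∈_ to _∈ˡ_)
open import Data.List.Relation.Unary.Any using (here; there)
open import Data.List.Relation.Unary.All using ([]; _∷_)
open import Data.List.Relation.Unary.All.Properties using (all-filter; applyUpTo⁺₁)
open import Data.List.Relation.Unary.Linked using ([]; [-]; _∷_)
open import Data.List.Relation.Binary.Sublist.Propositional using (_⊆_; []; _∷_; _∷ʳ_; ⊆-trans; minimum)
open import Data.List.Relation.Binary.Sublist.Propositional.Properties using (filter-⊆; filter⁺; map⁺; All-resp-⊆; Any-resp-⊆)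
open import Data.Nat.Base
open import Data.Nat.Properties
open import Data.Nat.Induction using (<-wellFounded)
open import Data.Product using (Σ; ∃-syntax; ∃₂; _×_; _,_; proj₁; proj₂)
open import Data.Sum.Base using (_⊎_; inj₁; inj₂; [_,_]′)
open import Data.Vec.Base as Vec using (Vec; []; _∷_; lookup)
open import Function.Base using (_∘_; flip; id)
open import Function.Bundles using (_⇔_; mk⇔; Equivalence)
open import Induction.WellFounded using (Acc; acc)
open import Level using (0ℓ)
open import Relation.Binary.Core using (Rel)
open import Relation.Binary.Definitions using (tri<; tri≈; tri>)
open import Relation.Binary.PropositionalEquality hiding ([_])
open import Relation.Nullary using (¬_; yes; no; contradiction)
open import Relation.Nullary.Decidable using (⌊_⌋; _×-dec_; toWitness; fromWitness)

-- Let H be the column heights of F.  An increasing sequence in R(V) is a chain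
-- built by adding markers at its upper right end, and 312 is reduced to 231 by
-- reflecting everything in the line y = x.
--
-- Diagonal condition.  Let the diagonal from (a , c + d) to (a + d , c) lie in F.
-- A chain in the first rectangle whose last marker y is in row ≥ c continues,
-- after removing y, to some marker below row c in the columns a , … , a + d - 1:
-- since y occupies one of the rows c + u , … , c + d - 1, the first d - u of these
-- columns contain a marker below row c + u, which by 231-avoidance is above
-- everything in the chain before y; now decrease u.
--
-- Existence.  Let V be the top right corner of the last column, with neighbours
-- V₁ to the left and V₂ below on the border; V₁ ≤ V₂ in value.  If the value
-- drops from V to V₂, the last column and its top row are deleted, and put back
-- with a marker in their common square.  Otherwise this square is cut off, and
-- the vertex V₀ opposite to V gets the largest value compatible with the
-- conditions; a realisation on the smaller board is also one on F.

open Equivalence using (to; from)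

-- Chains, boards and conditions in terms of column heights.

private variable
  a a′ b b′ c d i j k l l′ n x y z : ℕ
  σ H K : ℕ → ℕ
  f : ℕ → ℕ → ℕ
  τ xs : List ℕ
  On On′ Cell Cell′ : ℕ → ℕ → Set
  _∼_ : Rel ℕ 0ℓ

-- An increasing sequence of l markers (i , π i) in R(a , b).
data Chain (π : ℕ → ℕ) : ℕ → ℕ → ℕ → Set where
  []   : Chain π a b 0
  snoc : ∀ i → i < a → π i < b → Chain π i (π i) l → Chain π a b (suc l)

widen : a ≤ a′ → b ≤ b′ → Chain σ a b l → Chain σ a′ b′ l
widen _ _ [] = []
widen p q (snoc i r s c) = snoc i (<-≤-trans r p) (<-≤-trans s q) c

shorten : l ≤ l′ → Chain σ a b l′ → Chain σ a b l
shorten z≤n       _              = []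
shorten (s≤s l≤) (snoc i p q c) = snoc i p q (shorten l≤ c)

-- Excluding the single length `suc l` excludes all greater ones, because `shorten` truncates any
-- chain.
Longest : (ℕ → ℕ) → ℕ → ℕ → ℕ → Set
Longest π a b l = Chain π a b l × ¬ Chain π a b (suc l)

chain≤longest : Chain σ a b l → Longest σ a b l′ → l ≤ l′
chain≤longest c (_ , ¬c) = ≮⇒≥ λ lt → ¬c (shorten lt c)

-- H 0 is the size of the board and H (suc i) the height of column i.
record Shape (n : ℕ) (H : ℕ → ℕ) : Set where
  field
    top  : H 0 ≡ n
    anti : i ≤ j → j ≤ n → H j ≤ H i

-- At a border vertex the column on the left reaches height `b` and the column on the right does not
-- exceed it. For `a = 0` the size `H 0` stands in for the missing left column; for `a = n` there is
-- no right column, and the border runs down to height 0.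
record OnBorder (n : ℕ) (H : ℕ → ℕ) (a b : ℕ) : Set where
  constructor onBorder
  field
    a≤n   : a ≤ n
    below : b ≤ H a
    above : a < n → H (suc a) ≤ b

open OnBorder

-- The monotonicity condition for adjacent vertices, and the 0-condition in
-- the form it then takes: the larger of the two values is positive.
record Grows (x y : ℕ) : Set where
  constructor grows
  field
    mono : x ≤ y
    slow : y ≤ suc x
    pos  : 1 ≤ y

open Grows

-- The border, the squares and the relation in `diag` are parameters, so that reflected boards and
-- both patterns are covered. The function `f` is total but is meant to be read at border vertices.
record Conditions (n : ℕ) (On Cell : ℕ → ℕ → Set) (_∼_ : Rel ℕ 0ℓ) (f : ℕ → ℕ → ℕ) : Set where
  field
    start : f 0 n ≡ 0
    end   : f n 0 ≡ 0
    right : On a b → On (suc a) b → Grows (f a b) (f (suc a) b)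
    up    : On a b → On a (suc b) → Grows (f a b) (f a (suc b))
    diag  : ∀ d → b ≡ c + d → a′ ≡ a + d → On a b → On a′ c →
            (∀ t u → suc (t + u) ≡ d → Cell (a + t) (c + u)) → f a b ∼ f a′ c

InColumn : (ℕ → ℕ) → ℕ → ℕ → Set
InColumn H i j = j < H (suc i)

record Permutes (n : ℕ) (H π ρ : ℕ → ℕ) : Set where
  field
    fits : i < n → π i < H (suc i)
    ρ<   : j < n → ρ j < n
    πρ   : j < n → π (ρ j) ≡ j
    ρπ   : i < n → ρ (π i) ≡ i

  injective : i < n → j < n → π i ≡ π j → i ≡ j
  injective i<n j<n eq = trans (sym (ρπ i<n)) (trans (cong ρ eq) (ρπ j<n))

-- The markers of columns i < j < k lie in R(V) for some border vertex V
-- exactly when π j < H (suc k), if π j is the largest of the three heights.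
No231 : ℕ → (ℕ → ℕ) → (ℕ → ℕ) → Set
No231 n H π = ∀ {i j k} → i < j → j < k → k < n →
              π k < π i → π i < π j → H (suc k) ≤ π j

Realises : ℕ → (ℕ → ℕ) → (ℕ → ℕ) → (ℕ → ℕ → ℕ) → Set
Realises n H π f = ∀ {a b} → OnBorder n H a b → Longest π a b (f a b)

-- Necessity of the conditions

module Necessity {n H π ρ} (sh : Shape n H) (pm : Permutes n H π ρ) (av : No231 n H π) where
  open Shape sh
  open Permutes pm

  -- If the last marker `p` of the chain were above that of column `y`, then `p`, `x`, `y` would
  -- form a 231 with highest marker `x`, and by `joint` some rectangle of the board would contain
  -- it. Hence `p` lies below, and the chain can also be continued by `y`.
  chain-propagates : x < y → y < n → π x < H (suc y) →
                     Chain π x (π x) l → Chain π y (π y) l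
  chain-propagates x<y y<n joint [] = []
  chain-propagates {x} {y} x<y y<n joint (snoc p p<x πp<πx ch) with <-cmp (π p) (π y)
  ... | tri< πp<πy _ _ = snoc p (<-trans p<x x<y) πp<πy ch
  ... | tri≈ _ πp≡πy _ =
    contradiction (injective (<-trans p<x (<-trans x<y y<n)) y<n πp≡πy) (<⇒≢ (<-trans p<x x<y))
  ... | tri> _ _ πy<πp = contradiction (av p<x x<y y<n πy<πp πp<πx) (<⇒≱ joint)

  -- k columns and one further marker cannot all use the k rows r , … , r + k - 1.
  low-marker : ∀ {a k r x} → a + k ≤ n → x < a → r ≤ π x → π x < r + k →
               (∀ t → t < k → π (a + t) < r + k) → ∃[ t ] t < k × π (a + t) < r
  low-marker {a} {k} {r} {x} a+k≤n x<a r≤πx πx<r+k π<r+k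
    with anyUpTo? (λ t → π (a + t) <? r) k
  ... | yes found = found
  ... | no none   = contradiction same-column (distinct (proj₁ (proj₂ (proj₂ clash))))
    where
    col : Fin (suc k) → ℕ
    col zero    = x
    col (suc t) = a + toℕ t

    col< : ∀ t → col t < n
    col< zero    = <-≤-trans x<a (m+n≤o⇒m≤o a a+k≤n)
    col< (suc t) = <-≤-trans (+-monoʳ-< a (toℕ<n t)) a+k≤n

    r≤πcol : ∀ t → r ≤ π (col t)
    r≤πcol zero    = r≤πx
    r≤πcol (suc t) = ≮⇒≥ λ lt → none (toℕ t , toℕ<n t , lt)

    πcol< : ∀ t → π (col t) < k + r
    πcol< zero    = subst (π x <_) (+-comm r k) πx<r+k
    πcol< (suc t) = subst (π (a + toℕ t) <_) (+-comm r k) (π<r+k (toℕ t) (toℕ<n t))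

    offset< : ∀ t → π (col t) ∸ r < k
    offset< t = +-cancelʳ-< r _ _ (subst (_< k + r) (sym (m∸n+n≡m (r≤πcol t))) (πcol< t))

    clash = pigeonhole (n<1+n k) (λ t → fromℕ< (offset< t))
    s₁ = proj₁ clash
    s₂ = proj₁ (proj₂ clash)

    same-column : col s₁ ≡ col s₂
    same-column = injective (col< s₁) (col< s₂) (∸-cancelʳ-≡ (r≤πcol s₁) (r≤πcol s₂)
      (trans (sym (toℕ-fromℕ< (offset< s₁)))
        (trans (cong toℕ (proj₂ (proj₂ (proj₂ clash)))) (toℕ-fromℕ< (offset< s₂)))))

    distinct : ∀ {s t} → s Fin.< t → col s ≢ col t
    distinct {zero}  {suc t} _         eq = <⇒≢ (<-≤-trans x<a (m≤m+n a (toℕ t))) eq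
    distinct {suc s} {suc t} (s<s s<t) eq = <⇒≢ s<t (+-cancelˡ-≡ a _ _ eq)

  module _ {a c d} (V₁ : OnBorder n H a (c + d)) (V₂ : OnBorder n H (a + d) c)
           (inside : ∀ t u → suc (t + u) ≡ d → c + u < H (suc (a + t))) where

    private
      column< : ∀ {t} → t < d → a + t < n
      column< t<d = <-≤-trans (+-monoʳ-< a t<d) (a≤n V₂)

      cell : ∀ t u → t + u < d → c + u < H (suc (a + t))
      cell t u t+u<d = ≤-<-trans
        (+-monoʳ-≤ c (m+n≤o⇒m≤o∸n u (subst (_≤ d) (+-comm (suc t) u) t+u<d)))
        (inside t (d ∸ suc t) (m+[n∸m]≡n (m+n≤o⇒m≤o (suc t) t+u<d)))

      row< : ∀ t → t < d → π (a + t) < c + d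
      row< t t<d = <-≤-trans (fits (column< t<d))
        (≤-trans (anti (s≤s (m≤m+n a t)) (column< t<d))
                 (above V₁ (≤-<-trans (m≤m+n a t) (column< t<d))))

    -- The invariant is that each of the first `d ∸ u` columns from `a` on continues a chain of
    -- length `l`. The marker found below row `c + u` in column `a + t` either lies below row `c` or
    -- has height `c + u′` with `u′ < u`. In the second case the columns that join for `u′` lie to
    -- the right of `a + t`, and the square in row `c + u′` of each of them is in the board, so the
    -- chain propagates there.
    descend : ∀ u → Acc _<_ u → x < a → c + u ≤ π x → π x < c + d →
              (∀ t → t + u < d → Chain π (a + t) (π (a + t)) l) →
              ∃[ t ] t < d × π (a + t) < c × Chain π (a + t) (π (a + t)) l
    descend {x = x} {l = l} u (acc rec) x<a c+u≤πx πx<c+d chains =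
      let t , t<d∸u , πt<c+u = low-marker {k = d ∸ u} {r = c + u}
            (≤-trans (+-monoʳ-≤ a (m∸n≤m d u)) (a≤n V₂)) x<a c+u≤πx
            (subst (π x <_) (sym height) πx<c+d)
            (λ t t< → subst (π (a + t) <_) (sym height) (row< t (<-≤-trans t< (m∸n≤m d u))))
      in continue t (m≤o∸n⇒m+n≤o (suc t) u≤d t<d∸u) πt<c+u
      where
      u≤d : u ≤ d
      u≤d = <⇒≤ (+-cancelˡ-< c u d (≤-<-trans c+u≤πx πx<c+d))

      height : c + u + (d ∸ u) ≡ c + d
      height = trans (+-assoc c u (d ∸ u)) (cong (c +_) (m+[n∸m]≡n u≤d))

      continue : ∀ t → t + u < d → π (a + t) < c + u →
                 ∃[ t ] t < d × π (a + t) < c × Chain π (a + t) (π (a + t)) l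
      continue t t+u<d πt<c+u with π (a + t) <? c
      ... | yes πt<c = t , ≤-<-trans (m≤m+n t u) t+u<d , πt<c , chains t t+u<d
      ... | no  πt≮c = descend u′ (rec u′<u) x<a (≤-trans (+-monoʳ-≤ c (<⇒≤ u′<u)) c+u≤πx) πx<c+d chains′
        where
        u′ = π (a + t) ∸ c

        c+u′≡πt : c + u′ ≡ π (a + t)
        c+u′≡πt = m+[n∸m]≡n (≮⇒≥ πt≮c)

        u′<u : u′ < u
        u′<u = +-cancelˡ-< c u′ u (subst (_< c + u) (sym c+u′≡πt) πt<c+u)

        chains′ : ∀ s → s + u′ < d → Chain π (a + s) (π (a + s)) l
        chains′ s s+u′<d with s + u <? d
        ... | yes s+u<d = chains s s+u<d
        ... | no  s+u≮d = chain-propagates (+-monoʳ-< a t<s) (column< (≤-<-trans (m≤m+n s u′) s+u′<d))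
                (subst (_< H (suc (a + s))) c+u′≡πt (cell s u′ s+u′<d)) (chains t t+u<d)
          where
          t<s : t < s
          t<s = +-cancelʳ-< u t s (<-≤-trans t+u<d (≮⇒≥ s+u≮d))

    chain-across : Chain π a (c + d) l → Chain π (a + d) c l
    chain-across [] = []
    chain-across (snoc i i<a πi<c+d ch) with π i <? c
    ... | yes πi<c = snoc i (<-≤-trans i<a (m≤m+n a d)) πi<c ch
    ... | no  πi≮c =
      -- Initially `u` is the height of the removed marker `i` above row `c`. The chain before `i`
      -- propagates to every column whose square in row `c + u` is on the diagonal or below it.
      let t , t<d , πt<c , ch′ = descend (π i ∸ c) (<-wellFounded _) i<a (≤-reflexive c+u≡πi) πi<c+d
            (λ t t+u<d → chain-propagates (<-≤-trans i<a (m≤m+n a t))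
              (column< (≤-<-trans (m≤m+n t _) t+u<d))
              (subst (_< H (suc (a + t))) c+u≡πi (cell t _ t+u<d)) ch)
      in snoc (a + t) (+-monoʳ-< a t<d) πt<c ch′
      where
      c+u≡πi : c + (π i ∸ c) ≡ π i
      c+u≡πi = m+[n∸m]≡n (≮⇒≥ πi≮c)

  conditions : Realises n H π f → Conditions n (OnBorder n H) (InColumn H) _≤_ f
  conditions {f = f} real = record
    { start = n≤0⇒n≡0 (≮⇒≥ λ pos → no-column (shorten pos (proj₁ (real (onBorder z≤n (≤-reflexive (sym top))
                λ 0<n → subst (H 1 ≤_) top (anti z≤n 0<n))))))
    ; end   = n≤0⇒n≡0 (≮⇒≥ λ pos → no-row (shorten pos (proj₁ (real (onBorder ≤-refl z≤n
                λ n<n → contradiction n<n (n≮n n))))))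
    ; right = right
    ; up    = up
    ; diag  = λ { d refl refl V₁ V₂ inside → chain≤longest (chain-across V₁ V₂ inside (proj₁ (real V₁))) (real V₂) }
    }
    where
    no-column : ∀ {b} → ¬ Chain π 0 b 1
    no-column (snoc _ () _ _)

    no-row : ∀ {a} → ¬ Chain π a 0 1
    no-row (snoc _ _ () _)

    right : OnBorder n H a b → OnBorder n H (suc a) b → Grows (f a b) (f (suc a) b)
    right {a} {b} p q = grows
      (chain≤longest (widen (n≤1+n a) ≤-refl (proj₁ (real p))) (real q))
      (≮⇒≥ λ lt → proj₂ (real p) (drop (shorten lt (proj₁ (real q)))))
      -- The marker of column `a` lies below height `b`, so the larger rectangle contains a marker:
      -- this is the 0-condition.
      (chain≤longest (snoc a (n<1+n a) (<-≤-trans (fits (a≤n q)) (above p (a≤n q))) []) (real q))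
      where
      drop : ∀ {l} → Chain π (suc a) b (suc l) → Chain π a b l
      -- All markers but the last lie strictly to the left of it, hence to the left of column `a`.
      drop (snoc i i≤a πi<b ch) = widen (s≤s⁻¹ i≤a) (<⇒≤ πi<b) ch

    up : OnBorder n H a b → OnBorder n H a (suc b) → Grows (f a b) (f a (suc b))
    up {a} {b} p q = grows
      (chain≤longest (widen ≤-refl (n≤1+n b) (proj₁ (real p))) (real q))
      (≮⇒≥ λ lt → proj₂ (real p) (drop (shorten lt (proj₁ (real q)))))
      (chain≤longest (snoc (ρ b) ρb<a (s≤s (≤-reflexive (πρ b<n))) []) (real q))
      where
      drop : ∀ {l} → Chain π a (suc b) (suc l) → Chain π a b l
      drop (snoc i i<a πi≤b ch) = widen (<⇒≤ i<a) (s≤s⁻¹ πi≤b) ch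
      b<n : b < n
      b<n = ≤-trans (below q) (subst (H a ≤_) top (anti z≤n (a≤n q)))
      ρb<a : ρ b < a
      -- From `a` on all columns have height at most `b`, so the marker of row `b` must be further
      -- left.
      ρb<a = ≰⇒> λ a≤ρb → <⇒≱ (subst (_< H (suc (ρ b))) (πρ b<n) (fits (ρ< b<n)))
        (≤-trans (anti (s≤s a≤ρb) (ρ< b<n)) (above p (≤-<-trans a≤ρb (ρ< b<n))))

-- Sufficiency of the conditions

_[_≔_] : (ℕ → ℕ) → ℕ → ℕ → ℕ → ℕ
(g [ k ≔ v ]) i with i ≟ k
... | yes _ = v
... | no  _ = g i

update-at : ∀ g k v → (g [ k ≔ v ]) k ≡ v
update-at g k v with k ≟ k
... | yes _  = refl
... | no k≢k = contradiction refl k≢k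

update-off : ∀ g {k v} → i ≢ k → (g [ k ≔ v ]) i ≡ g i
update-off {i} g {k} i≢k with i ≟ k
... | yes i≡k = contradiction i≡k i≢k
... | no  _   = refl

record Realisation (n : ℕ) (H : ℕ → ℕ) (f : ℕ → ℕ → ℕ) : Set where
  field
    π ρ      : ℕ → ℕ
    permutes : Permutes n H π ρ
    no231    : No231 n H π
    realises : Realises n H π f

module _ {n H f} (sh : Shape n H) (cs : Conditions n (OnBorder n H) (InColumn H) _≤_ f) where
  open Shape sh
  open Conditions cs

  -- Follow the diagonal up and left from (a , y) while it stays inside the
  -- board.  It would have to leave the board at a border vertex of value 0
  -- that is reached by a step to the right, unless it gets to x = 0.
  zero⇒antidiagonal : OnBorder n H a y → f a y ≡ 0 → a + y ≤ n
  zero⇒antidiagonal {a} {y} Z fZ≡0 =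
    go a 0 (sym (+-identityʳ a)) (subst (_≤ H a) (sym (+-identityʳ y)) (below Z)) (λ _ _ ())
    where
    go : ∀ x d → a ≡ x + d → y + d ≤ H x →
         (∀ t u → suc (t + u) ≡ d → y + u < H (suc (x + t))) → a + y ≤ n
    go zero d refl y+d≤H inside = subst₂ _≤_ (+-comm y d) top y+d≤H
    go (suc x) d refl y+d≤H inside with y + d <? H (suc x)
    ... | yes y+d<H = go x (suc d) (sym (+-suc x d))
            (≤-trans (subst (_≤ H (suc x)) (sym (+-suc y d)) y+d<H) (anti (n≤1+n x) x<n)) inside′
      where
      x<n : x < n
      x<n = ≤-trans (s≤s (m≤m+n x d)) (a≤n Z)
      inside′ : ∀ t u → suc (t + u) ≡ suc d → y + u < H (suc (x + t))
      inside′ zero    u eq = subst₂ _<_ (cong (y +_) (sym (suc-injective eq))) (cong (λ z → H (suc z)) (sym (+-identityʳ x))) y+d<H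
      inside′ (suc t) u eq = subst (λ z → y + u < H (suc z)) (sym (+-suc x t)) (inside t u (suc-injective eq))
    ... | no y+d≮H = contradiction (pos (right before U))
            (≤⇒≯ (≤-trans (diag d refl refl U Z inside) (≤-reflexive fZ≡0)))
      where
      x<n : x < n
      x<n = ≤-trans (s≤s (m≤m+n x d)) (a≤n Z)
      U : OnBorder n H (suc x) (y + d)
      U = onBorder x<n y+d≤H λ x<n → ≤-trans (anti (n≤1+n (suc x)) x<n) (≮⇒≥ y+d≮H)
      before : OnBorder n H x (y + d)
      before = onBorder (<⇒≤ x<n) (≤-trans y+d≤H (anti (n≤1+n x) x<n)) λ _ → ≮⇒≥ y+d≮H

  -- The border need not stay away from the diagonal ending at (m , b); the
  -- vertex where it last touches that diagonal is one step to the left of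
  -- a vertex on the diagonal ending at (m , suc b).
  left-of-corner : ∀ {m} r → OnBorder n H m (suc b) → OnBorder n H x (b + suc r) → m ≡ x + suc r →
                   (∀ t u → suc (t + u) ≡ suc r → b + u < H (suc (x + t))) →
                   f x (b + suc r) ≤ f m (suc b)
  left-of-corner {b} {x} {m} r V₁ W m≡ inside = go r 0 (+-identityʳ r) (λ _ _ ())
    where
    m≡′ : ∀ q e → q + e ≡ r → m ≡ suc (x + q) + e
    m≡′ q e eq = begin
      m                ≡⟨ m≡ ⟩
      x + suc r        ≡⟨ +-suc x r ⟩
      suc (x + r)      ≡⟨ cong (λ z → suc (x + z)) eq ⟨
      suc (x + (q + e)) ≡⟨ cong suc (+-assoc x q e) ⟨
      suc (x + q) + e  ∎
      where open ≡-Reasoning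

    -- Here `e` counts the squares, going left from (`m` , `suc b`), through which its diagonal is
    -- known to stay in the board; `q` further columns separate the point reached from the right
    -- neighbour of `W`.
    go : ∀ q e → q + e ≡ r → (∀ t u → suc (t + u) ≡ e → suc b + u < H (suc (suc (x + q) + t))) →
         f x (b + suc r) ≤ f m (suc b)
    go zero e refl inside′ = ≤-trans
        (mono (right W W′))
        (diag e (+-suc b e) (trans (m≡′ 0 e refl) (cong (λ z → suc z + e) (+-identityʳ x))) W′ V₁
          λ t u eq → subst (λ z → suc b + u < H (suc (suc z + t))) (+-identityʳ x) (inside′ t u eq))
      where
      x<n : x < n
      x<n = ≤-trans (m≤m+n (suc x) e) (subst (_≤ n) (trans m≡ (+-suc x e)) (a≤n V₁))
      W′ : OnBorder n H (suc x) (b + suc e)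
      W′ = onBorder x<n
             (subst₂ _≤_ (sym (+-suc b e)) (cong (λ z → H (suc z)) (+-identityʳ x)) (inside 0 e refl))
             λ x<n′ → ≤-trans (anti (n≤1+n (suc x)) x<n′) (above W x<n)
    go (suc q) e refl inside′ with suc b + e <? H (suc (suc (x + q)))
    ... | yes lt = go q (suc e) (+-suc q e) inside″
      where
      inside″ : ∀ t u → suc (t + u) ≡ suc e → suc b + u < H (suc (suc (x + q) + t))
      inside″ zero    u eq = subst₂ _<_ (cong (suc b +_) (sym (suc-injective eq))) (cong (λ z → H (suc (suc z))) (sym (+-identityʳ (x + q)))) lt
      inside″ (suc t) u eq = subst (λ z → suc b + u < H (suc (suc z)))
        (trans (cong (_+ t) (+-suc x q)) (sym (+-suc (x + q) t))) (inside′ t u (suc-injective eq))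
    ... | no ≮H = begin
      f x (b + suc r)                ≤⟨ diag (suc q) height (sym (+-suc x q)) W U W⇒U ⟩
      f (suc (x + q)) (suc b + e)    ≤⟨ mono (right U X) ⟩
      f (suc (suc (x + q))) (suc b + e) ≤⟨ diag e refl (trans (m≡′ (suc q) e refl) (cong (λ z → suc z + e) (+-suc x q))) X V₁
                                        (λ t u eq → subst (λ z → suc b + u < H (suc (suc z + t))) (+-suc x q) (inside′ t u eq)) ⟩
      f m (suc b) ∎
      where
      open ≤-Reasoning
      height : b + suc (suc q + e) ≡ suc b + e + suc q
      height = trans (+-suc b (suc q + e)) (cong suc (trans (cong (b +_) (+-comm (suc q) e)) (sym (+-assoc b e (suc q)))))
      x+q<n : suc (x + q) < n
      x+q<n = ≤-trans (m≤m+n (suc (suc (x + q))) e)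
        (subst (_≤ n) (trans (m≡′ (suc q) e refl) (cong (λ z → suc z + e) (+-suc x q))) (a≤n V₁))
      U : OnBorder n H (suc (x + q)) (suc b + e)
      U = onBorder (<⇒≤ x+q<n)
            (≤-trans (≤-reflexive (sym (+-suc b e))) (<⇒≤ (inside q (suc e) (cong suc (+-suc q e)))))
            λ _ → ≮⇒≥ ≮H
      X : OnBorder n H (suc (suc (x + q))) (suc b + e)
      X = onBorder x+q<n
            (subst (λ z → b + e < H (suc z)) (+-suc x q) (inside (suc q) e refl))
            λ lt → ≤-trans (anti (n≤1+n _) lt) (≮⇒≥ ≮H)
      W⇒U : ∀ t u → suc (t + u) ≡ suc q → suc b + e + u < H (suc (x + t))
      W⇒U t u eq = subst (_< H (suc (x + t))) (trans (+-suc b (e + u)) (cong suc (sym (+-assoc b e u)))) (inside t (suc (e + u))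
        (cong suc (trans (+-suc t (e + u)) (trans (cong suc (trans (cong (t +_) (+-comm e u)) (sym (+-assoc t u e)))) (cong (_+ e) eq)))))

-- The last corner of the board and its removal.

module LastCorner {m b H f} (sh : Shape (suc m) H) (h≡ : H (suc m) ≡ suc b)
              (cs : Conditions (suc m) (OnBorder (suc m) H) (InColumn H) _≤_ f) where
  open Shape sh
  open Conditions cs

  b<H : i ≤ suc m → b < H i
  b<H {i} i≤ = subst (_≤ H i) h≡ (anti i≤ ≤-refl)

  V : OnBorder (suc m) H (suc m) (suc b)
  V = onBorder ≤-refl (b<H ≤-refl) λ lt → contradiction lt (n≮n _)

  V₁ : OnBorder (suc m) H m (suc b)
  V₁ = onBorder (n≤1+n m) (b<H (n≤1+n m)) λ _ → ≤-reflexive h≡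

  V₂ : OnBorder (suc m) H (suc m) b
  V₂ = onBorder ≤-refl (<⇒≤ (b<H ≤-refl)) λ lt → contradiction lt (n≮n _)

  V₁≤V₂ : f m (suc b) ≤ f (suc m) b
  V₁≤V₂ = diag 1 (+-comm 1 b) (+-comm 1 m) V₁ V₂
    λ { zero zero refl → subst₂ _<_ (sym (+-identityʳ b)) (cong (λ z → H (suc z)) (sym (+-identityʳ m))) (b<H ≤-refl) }

-- When the value drops from V to V₂, the square below and to the left of V
-- has to carry a marker, which is removed with its row and its column.
module Delete {m b H f} (sh : Shape (suc m) H) (h≡ : H (suc m) ≡ suc b)
              (cs : Conditions (suc m) (OnBorder (suc m) H) (InColumn H) _≤_ f)
              (V₂<V : f (suc m) b < f (suc m) (suc b)) where
  open Shape sh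
  open Conditions cs
  open LastCorner sh h≡ cs

  -- From `V₁` to `V` the value grows by at most one, so a drop from `V` to `V₂` brings the value at
  -- `V₂` down to at most that at `V₁`; the diagonal condition gives the converse.
  V₁≡V₂ : f m (suc b) ≡ f (suc m) b
  V₁≡V₂ = ≤-antisym V₁≤V₂ (s≤s⁻¹ (≤-trans V₂<V (slow (right V₁ V))))

  V≡ : f (suc m) (suc b) ≡ suc (f (suc m) b)
  V≡ = ≤-antisym (slow (up V₂ V)) V₂<V

  -- Row `b` meets every column, so its deletion shortens each by one; the size `H 0` decreases by
  -- one as well.
  H′ : ℕ → ℕ
  H′ = pred ∘ H

  suc-H′ : i ≤ suc m → suc (H′ i) ≡ H i
  suc-H′ i≤ = suc-pred _ {{>-nonZero (≤-<-trans z≤n (b<H i≤))}}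

  shape′ : Shape m H′
  shape′ = record { top = cong pred top ; anti = λ i≤j j≤m → pred-mono-≤ (anti i≤j (m≤n⇒m≤1+n j≤m)) }

  b≤H′ : i ≤ suc m → b ≤ H′ i
  b≤H′ i≤ = <⇒≤pred (b<H i≤)

  -- Below height `b` the smaller board has only the vertices of its right side x = `m`, which come
  -- from x = `suc m`; from height `b` on, the vertices come from one unit higher. The vertices `V₁`
  -- and `V₂` merge into (`m` , `b`), which is consistent by `V₁≡V₂`.
  f′ : ℕ → ℕ → ℕ
  f′ a y with y <? b
  ... | yes _ = f (suc m) y
  ... | no  _ = f a (suc y)

  f′-high : ∀ a → b ≤ y → f′ a y ≡ f a (suc y)
  f′-high {y} a b≤y with y <? b
  ... | yes y<b = contradiction b≤y (<⇒≱ y<b)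
  ... | no  _   = refl

  f′-low : y ≤ b → f′ m y ≡ f (suc m) y
  f′-low {y} y≤b with y <? b
  ... | yes _   = refl
  ... | no  y≮b with refl ← ≤-antisym y≤b (≮⇒≥ y≮b) = V₁≡V₂

  raise : b ≤ y → OnBorder m H′ a y → OnBorder (suc m) H a (suc y)
  raise {y} b≤y p = onBorder (m≤n⇒m≤1+n (a≤n p)) (subst (suc y ≤_) (suc-H′ (m≤n⇒m≤1+n (a≤n p))) (s≤s (below p))) high
    where
    high : _ < suc m → H (suc _) ≤ suc y
    high a<sm with m≤n⇒m<n∨m≡n (s≤s⁻¹ a<sm)
    ... | inj₁ a<m  = subst (_≤ suc y) (suc-H′ (s≤s (<⇒≤ a<m))) (s≤s (above p a<m))
    ... | inj₂ refl = ≤-trans (≤-reflexive h≡) (s≤s b≤y)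

  lower : y ≤ b → OnBorder m H′ a y → y ≡ b ⊎ a ≡ m
  lower {y} {a} y≤b p with m≤n⇒m<n∨m≡n (a≤n p)
  ... | inj₁ a<m = inj₁ (≤-antisym y≤b (≤-trans (b≤H′ (m≤n⇒m≤1+n a<m)) (above p a<m)))
  ... | inj₂ a≡m = inj₂ a≡m

  low : y < b → OnBorder m H′ a y → a ≡ m
  low y<b p with lower (<⇒≤ y<b) p
  ... | inj₁ y≡b = contradiction y≡b (<⇒≢ y<b)
  ... | inj₂ a≡m = a≡m

  last-column : y ≤ suc b → OnBorder (suc m) H (suc m) y
  last-column y≤ = onBorder ≤-refl (≤-trans y≤ (≤-reflexive (sym h≡))) λ lt → contradiction lt (n≮n _)

  conditions′ : Conditions m (OnBorder m H′) (InColumn H′) _≤_ f′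
  conditions′ = record
    { start = trans (f′-high 0 (subst (b ≤_) (cong pred top) (b≤H′ z≤n))) start
    ; end   = trans (f′-low z≤n) end
    ; right = right′ ; up = up′ ; diag = diag′ }
    where
    right′ : OnBorder m H′ a y → OnBorder m H′ (suc a) y → Grows (f′ a y) (f′ (suc a) y)
    right′ {a} {y} p q = subst₂ Grows (sym (f′-high a b≤y)) (sym (f′-high (suc a) b≤y))
                           (right (raise b≤y p) (raise b≤y q))
      where
      b≤y : b ≤ y
      b≤y = ≤-trans (b≤H′ (m≤n⇒m≤1+n (a≤n q))) (above p (a≤n q))

    up′ : OnBorder m H′ a y → OnBorder m H′ a (suc y) → Grows (f′ a y) (f′ a (suc y))
    up′ {a} {y} p q with b ≤? y
    ... | yes b≤y = subst₂ Grows (sym (f′-high a b≤y)) (sym (f′-high a (m≤n⇒m≤1+n b≤y)))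
                      (up (raise b≤y p) (raise (m≤n⇒m≤1+n b≤y) q))
    ... | no  b≰y with refl ← low (≰⇒> b≰y) p =
      subst₂ Grows (sym (f′-low (<⇒≤ (≰⇒> b≰y)))) (sym (f′-low (≰⇒> b≰y)))
        (up (last-column (m≤n⇒m≤1+n (<⇒≤ (≰⇒> b≰y)))) (last-column (m≤n⇒m≤1+n (≰⇒> b≰y))))

    diag′ : ∀ {a y a′ c} d → y ≡ c + d → a′ ≡ a + d → OnBorder m H′ a y → OnBorder m H′ a′ c →
            (∀ t u → suc (t + u) ≡ d → c + u < H′ (suc (a + t))) → f′ a y ≤ f′ a′ c
    diag′ {a} {y} {a′} {c} d refl refl p q inside with b ≤? c
    ... | yes b≤c = subst₂ _≤_ (sym (f′-high a b≤c+d)) (sym (f′-high (a + d) b≤c))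
            (diag d refl refl (raise b≤c+d p) (raise b≤c q)
              λ t u eq → subst (suc c + u <_) (suc-H′ (s≤s (≤-trans (+-monoʳ-≤ a (t≤ t u eq)) (a≤n q)))) (s≤s (inside t u eq)))
      where
      b≤c+d : b ≤ c + d
      b≤c+d = ≤-trans b≤c (m≤m+n c d)
      t≤ : ∀ t u → suc (t + u) ≡ d → t ≤ d
      t≤ t u refl = m≤n⇒m≤1+n (m≤m+n t u)
    ... | no b≰c with a+d≡m ← low (≰⇒> b≰c) q with b ≤? c + d
    -- Both ends lie on the line x = `m`, so the diagonal has length 0.
    ...   | no b≰c+d with refl ← low (≰⇒> b≰c+d) p
                     with refl ← +-cancelˡ-≡ a d 0 (trans a+d≡m (sym (+-identityʳ a))) =
              ≤-reflexive (cong₂ f′ (sym (+-identityʳ a)) (+-identityʳ c))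
    -- The diagonal meets the deleted row and column, so in the larger board it is one square
    -- longer; the extra square lies in column `m`.
    ...   | yes b≤c+d = subst₂ _≤_ (sym (f′-high a b≤c+d)) (trans (sym (f′-low (<⇒≤ (≰⇒> b≰c)))) (cong (λ z → f′ z c) (sym a+d≡m)))
              (diag (suc d) (sym (+-suc c d)) (trans (cong suc (sym a+d≡m)) (sym (+-suc a d)))
                (raise b≤c+d p) (last-column (m≤n⇒m≤1+n (<⇒≤ (≰⇒> b≰c)))) inside′)
      where
      inside′ : ∀ t u → suc (t + u) ≡ suc d → c + u < H (suc (a + t))
      inside′ t zero eq = ≤-<-trans (subst (_≤ b) (sym (+-identityʳ c)) (<⇒≤ (≰⇒> b≰c)))
        (b<H (s≤s (≤-reflexive (trans (cong (a +_) (trans (sym (+-identityʳ t)) (suc-injective eq))) a+d≡m))))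
      inside′ t (suc u) eq = subst₂ _≤_ (cong suc (sym (+-suc c u)))
        (suc-H′ (s≤s (≤-trans (+-monoʳ-≤ a (≤-trans (m≤m+n t (suc u)) (≤-reflexive (suc-injective eq)))) (≤-reflexive a+d≡m))))
        (s≤s (inside t u (trans (sym (+-suc t u)) (suc-injective eq))))

  -- The increasing enumeration of the rows other than `b`, which makes room for the reinserted row.
  shift : ℕ → ℕ
  shift j with j <? b
  ... | yes _ = j
  ... | no  _ = suc j

  unshift : ℕ → ℕ
  unshift j with j <? b
  ... | yes _ = j
  ... | no  _ = pred j

  shift-low : j < b → shift j ≡ j
  shift-low {j} j<b with j <? b
  ... | yes _   = refl
  ... | no  j≮b = contradiction j<b j≮b

  shift-high : b ≤ j → shift j ≡ suc j
  shift-high {j} b≤j with j <? b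
  ... | yes j<b = contradiction b≤j (<⇒≱ j<b)
  ... | no  _   = refl

  shift≢b : ∀ j → shift j ≢ b
  shift≢b j with j <? b
  ... | yes j<b = <⇒≢ j<b
  ... | no  j≮b = λ eq → <⇒≢ (s≤s (≮⇒≥ j≮b)) (sym eq)

  shift-mono : j < k → shift j < shift k
  shift-mono {j} {k} j<k with j <? b | k <? b
  ... | yes _   | yes _ = j<k
  ... | yes _   | no  _ = m≤n⇒m≤1+n j<k
  ... | no  j≮b | yes k<b = contradiction (<-trans j<k k<b) j≮b
  ... | no  _   | no  _ = s≤s j<k

  shift-cancel : shift j < shift k → j < k
  shift-cancel {j} {k} lt with <-cmp j k
  ... | tri< j<k _ _   = j<k
  ... | tri≈ _ refl _  = contradiction lt (n≮n _)
  ... | tri> _ _ k<j   = contradiction lt (<⇒≯ (shift-mono k<j))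

  unshift-shift : ∀ j → unshift (shift j) ≡ j
  unshift-shift j with j <? b
  unshift-shift j | yes j<b with j <? b
  ... | yes _   = refl
  ... | no  j≮b = contradiction j<b j≮b
  unshift-shift j | no j≮b with suc j <? b
  ... | yes sj<b = contradiction (<-trans (n<1+n j) sj<b) j≮b
  ... | no  _    = refl

  shift-unshift : j ≢ b → shift (unshift j) ≡ j
  shift-unshift {j} j≢b with j <? b
  ... | yes j<b = shift-low j<b
  ... | no  j≮b = trans (shift-high (<⇒≤pred b<j)) (suc-pred j {{>-nonZero (≤-<-trans z≤n b<j)}})
    where
    b<j : b < j
    b<j = ≤∧≢⇒< (≮⇒≥ j≮b) (j≢b ∘ sym)

  shift-<suc : b ≤ k → shift j < suc k → j < k
  shift-<suc {k} {j} b≤k lt = shift-cancel (subst (shift j <_) (sym (shift-high b≤k)) lt)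

  module _ (R : Realisation m H′ f′) where
    open Realisation R renaming (π to π′; ρ to ρ′; permutes to pm′; no231 to av′; realises to real′)
    open Permutes pm′ renaming (fits to fits′; ρ< to ρ′<; πρ to πρ′; ρπ to ρπ′)

    π ρ : ℕ → ℕ
    π = (shift ∘ π′) [ m ≔ b ]
    ρ = (ρ′ ∘ unshift) [ b ≔ m ]

    π-off : i < m → π i ≡ shift (π′ i)
    π-off i<m = update-off (shift ∘ π′) (<⇒≢ i<m)

    π-at : π m ≡ b
    π-at = update-at (shift ∘ π′) m b

    b≤m : b ≤ m
    b≤m = subst (b ≤_) (cong pred top) (b≤H′ z≤n)

    unshift< : j < suc m → j ≢ b → unshift j < m
    unshift< {j} j<sm j≢b = shift-<suc b≤m (subst (_< suc m) (sym (shift-unshift j≢b)) j<sm)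

    permutes′ : Permutes (suc m) H π ρ
    permutes′ = record { fits = fits″ ; ρ< = ρ<″ ; πρ = πρ″ ; ρπ = ρπ″ }
      where
      fits″ : i < suc m → π i < H (suc i)
      fits″ {i} i<sm with m≤n⇒m<n∨m≡n (s≤s⁻¹ i<sm)
      ... | inj₂ refl = subst (_< H (suc m)) (sym π-at) (b<H ≤-refl)
      ... | inj₁ i<m  = subst₂ _<_ (sym (π-off i<m)) (trans (shift-high (b≤H′ i<sm)) (suc-H′ i<sm)) (shift-mono (fits′ i<m))

      ρ<″ : j < suc m → ρ j < suc m
      ρ<″ {j} j<sm with j ≟ b
      ... | yes _   = n<1+n m
      ... | no  j≢b = m≤n⇒m≤1+n (ρ′< (unshift< j<sm j≢b))

      πρ″ : j < suc m → π (ρ j) ≡ j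
      πρ″ {j} j<sm with j ≟ b
      ... | yes refl = π-at
      ... | no  j≢b  = trans (π-off (ρ′< u<)) (trans (cong shift (πρ′ u<)) (shift-unshift j≢b))
        where u< = unshift< j<sm j≢b

      ρπ″ : i < suc m → ρ (π i) ≡ i
      ρπ″ {i} i<sm with m≤n⇒m<n∨m≡n (s≤s⁻¹ i<sm)
      ... | inj₂ refl = trans (cong ρ π-at) (update-at (ρ′ ∘ unshift) b m)
      ... | inj₁ i<m  = trans (cong ρ (π-off i<m)) (trans (update-off (ρ′ ∘ unshift) (shift≢b (π′ i)))
                          (trans (cong ρ′ (unshift-shift (π′ i))) (ρπ′ i<m)))

    no231″ : No231 (suc m) H π
    no231″ {i} {j} {k} i<j j<k k<sm πk<πi πi<πj with m≤n⇒m<n∨m≡n (s≤s⁻¹ k<sm)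
    -- If the reinserted marker is the 1, the 3 lies above row `b`, the top row of column `m`.
    ... | inj₂ refl = ≤-trans (≤-reflexive h≡) (≤-trans (s≤s (subst (_≤ π i) π-at (<⇒≤ πk<πi))) πi<πj)
    ... | inj₁ k<m  = subst₂ _≤_ (suc-H′ k<sm) (sym (trans (π-off j<m) (shift-high (≤-trans (b≤H′ k<sm) H′≤)))) (s≤s H′≤)
      where
      j<m = <-trans j<k k<m
      i<m = <-trans i<j j<m
      H′≤ : H′ (suc k) ≤ π′ j
      H′≤ = av′ i<j j<k k<m (shift-cancel (subst₂ _<_ (π-off k<m) (π-off i<m) πk<πi))
              (shift-cancel (subst₂ _<_ (π-off i<m) (π-off j<m) πi<πj))

    chain⁺ : a ≤ m → Chain π′ a y l → Chain π a (shift y) l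
    chain⁺ a≤m [] = []
    chain⁺ a≤m (snoc i i<a πi<y ch) = snoc i i<a (subst (_< _) (sym πi≡) (shift-mono πi<y))
      (subst (λ z → Chain π i z _) (sym πi≡) (chain⁺ (<⇒≤ i<m) ch))
      where
      i<m = <-≤-trans i<a a≤m
      πi≡ = π-off i<m

    chain⁻ : a ≤ m → Chain π a (shift y) l → Chain π′ a y l
    chain⁻ a≤m [] = []
    chain⁻ a≤m (snoc i i<a πi<y ch) = snoc i i<a (shift-cancel (subst (_< _) πi≡ πi<y))
      (chain⁻ (<⇒≤ i<m) (subst (λ z → Chain π i z _) πi≡ ch))
      where
      i<m = <-≤-trans i<a a≤m
      πi≡ = π-off i<m

    longest⁺ : a ≤ m → b ≤ y → Longest π′ a y l → Longest π a (suc y) l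
    longest⁺ a≤m b≤y (ch , ¬ch) =
      subst (λ z → Chain π _ z _) (shift-high b≤y) (chain⁺ a≤m ch) ,
      ¬ch ∘ chain⁻ a≤m ∘ subst (λ z → Chain π _ z _) (sym (shift-high b≤y))

    -- The marker of column `m` is in row `b`, too high for this rectangle.
    narrow : y ≤ b → Chain π (suc m) y l → Chain π m y l
    narrow y≤b [] = []
    narrow y≤b (snoc i i<sm πi<y ch) with m≤n⇒m<n∨m≡n (s≤s⁻¹ i<sm)
    ... | inj₁ i<m  = snoc i i<m πi<y ch
    ... | inj₂ refl = contradiction y≤b (<⇒≱ (subst (_< _) π-at πi<y))

    low-chain⁺ : a ≤ m → y ≤ b → Chain π′ a y l → Chain π a y l
    low-chain⁺ a≤m y≤b [] = []
    low-chain⁺ {y = y} a≤m y≤b (snoc i i<a πi<y ch) = snoc i i<a (subst (_< y) (sym πi≡) πi<y)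
      (subst (λ z → Chain π i z _) (sym πi≡) (low-chain⁺ (<⇒≤ i<m) (<⇒≤ (<-≤-trans πi<y y≤b)) ch))
      where
      i<m = <-≤-trans i<a a≤m
      πi≡ = trans (π-off i<m) (shift-low (<-≤-trans πi<y y≤b))

    low-chain⁻ : a ≤ m → y ≤ b → Chain π a y l → Chain π′ a y l
    low-chain⁻ a≤m y≤b ch with m≤n⇒m<n∨m≡n y≤b
    ... | inj₁ y<b  = chain⁻ a≤m (subst (λ z → Chain π _ z _) (sym (shift-low y<b)) ch)
    ... | inj₂ refl = chain⁻ a≤m (widen ≤-refl (≤-trans (n≤1+n b) (≤-reflexive (sym (shift-high ≤-refl)))) ch)

    low-longest : y ≤ b → Longest π (suc m) y (f (suc m) y)
    low-longest {y} y≤b =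
      widen (n≤1+n m) ≤-refl (low-chain⁺ ≤-refl y≤b (proj₁ real)) ,
      proj₂ real ∘ low-chain⁻ ≤-refl y≤b ∘ narrow y≤b
      where
      real : Longest π′ m y (f (suc m) y)
      real = subst (Longest π′ m y) (f′-low y≤b)
        (real′ (onBorder ≤-refl (≤-trans y≤b (b≤H′ (n≤1+n m))) λ lt → contradiction lt (n≮n m)))

    -- The reinserted marker lies above and to the right of all of R(`m` , `b`), so it prolongs a
    -- longest chain there by one, in accordance with `V≡`.
    corner-longest : Longest π (suc m) (suc b) (suc (f (suc m) b))
    corner-longest =
      snoc m (n<1+n m) (subst (_< suc b) (sym π-at) (n<1+n b))
        (subst (λ z → Chain π m z _) (sym π-at) (narrow ≤-refl (proj₁ (low-longest ≤-refl)))) ,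
      λ { (snoc i i<sm πi<sb ch) → proj₂ (low-longest ≤-refl) (widen (<⇒≤ i<sm) (s≤s⁻¹ πi<sb) ch) }

    realises″ : Realises (suc m) H π f
    realises″ {a} {y} p with m≤n⇒m<n∨m≡n (a≤n p)
    ... | inj₂ refl with m≤n⇒m<n∨m≡n (≤-trans (below p) (≤-reflexive h≡))
    ...   | inj₁ y<sb = low-longest (s≤s⁻¹ y<sb)
    ...   | inj₂ refl = subst (Longest π (suc m) (suc b)) (sym V≡) corner-longest
    realises″ {a} {y} p | inj₁ a<sm = earlier y p (≤-trans (b<H a<sm) (above p a<sm))
      where
      earlier : ∀ y → OnBorder (suc m) H a y → b < y → Longest π a y (f a y)
      earlier (suc z) p b<y = subst (Longest π a (suc z)) (f′-high a (s≤s⁻¹ b<y))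
        (longest⁺ (s≤s⁻¹ a<sm) (s≤s⁻¹ b<y)
          (real′ (onBorder (s≤s⁻¹ a<sm) (<⇒≤pred (below p)) λ a<m → pred-mono-≤ (above p a<sm))))

    realisation : Realisation (suc m) H f
    realisation = record { permutes = permutes′ ; no231 = no231″ ; realises = realises″ }

-- Otherwise that square cannot carry a marker, and it is cut off the board.
module Lower {m c H f} (sh : Shape (suc m) H) (h≡ : H (suc m) ≡ suc (suc c))
             (cs : Conditions (suc m) (OnBorder (suc m) H) (InColumn H) _≤_ f)
             (V₂≡V : f (suc m) (suc c) ≡ f (suc m) (suc (suc c))) where
  open Shape sh
  open Conditions cs
  open LastCorner sh h≡ cs

  h : ℕ
  h = suc c

  H′ : ℕ → ℕ
  H′ = H [ suc m ≔ h ]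

  H′≡ : i ≤ m → H′ i ≡ H i
  H′≡ i≤m = update-off H (<⇒≢ (s≤s i≤m))

  H′-last : H′ (suc m) ≡ h
  H′-last = update-at H (suc m) h

  H′≤H : i ≤ suc m → H′ i ≤ H i
  H′≤H i≤ with m≤n⇒m<n∨m≡n i≤
  ... | inj₁ i<sm = ≤-reflexive (H′≡ (s≤s⁻¹ i<sm))
  ... | inj₂ refl = ≤-trans (≤-reflexive H′-last) (<⇒≤ (b<H ≤-refl))

  shape′ : Shape (suc m) H′
  shape′ = record { top = trans (H′≡ z≤n) top ; anti = anti′ }
    where
    anti′ : i ≤ j → j ≤ suc m → H′ j ≤ H′ i
    anti′ {i} {j} i≤j j≤ with m≤n⇒m<n∨m≡n (≤-trans i≤j j≤)
    ... | inj₁ i<sm = ≤-trans (H′≤H j≤) (≤-trans (anti i≤j j≤) (≤-reflexive (sym (H′≡ (s≤s⁻¹ i<sm)))))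
    ... | inj₂ refl = ≤-reflexive (cong H′ (≤-antisym j≤ i≤j))

  -- The last column has height at least two, so the border has a vertex below `V₂`; it ends the
  -- diagonal of one square that starts at V₀.
  V₃ : OnBorder (suc m) H (suc m) c
  V₃ = onBorder ≤-refl (≤-trans (n≤1+n c) (<⇒≤ (b<H ≤-refl))) λ lt → contradiction lt (n≮n _)

  -- The value at the new border vertex V₀ = (m , h).  The diagonal condition
  -- bounds it by the value at V₃, and the value at V₁ is an upper bound by
  -- monotonicity; the largest choice is the right one.
  V₀-value : ℕ
  V₀-value = f m (suc h) ⊓ f (suc m) c

  f′ : ℕ → ℕ → ℕ
  f′ a y with a ≟ m | y ≟ h
  ... | yes _ | yes _ = V₀-value
  ... | _     | _     = f a y

  f′-V₀ : f′ m h ≡ V₀-value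
  f′-V₀ with m ≟ m | h ≟ h
  ... | yes _   | yes _   = refl
  ... | no m≢m  | _       = contradiction refl m≢m
  ... | yes _   | no h≢h  = contradiction refl h≢h

  f′-off : ¬ (a ≡ m × y ≡ h) → f′ a y ≡ f a y
  f′-off {a} {y} off with a ≟ m | y ≟ h
  ... | yes a≡m | yes y≡h = contradiction (a≡m , y≡h) off
  ... | yes _   | no _    = refl
  ... | no _    | yes _   = refl
  ... | no _    | no _    = refl

  -- The two borders differ in one vertex only, V₀ instead of `V`, and every check on the lowered
  -- board splits accordingly.
  from-lowered : OnBorder (suc m) H′ a y → (a ≡ m × y ≡ h) ⊎ (OnBorder (suc m) H a y × f′ a y ≡ f a y)
  from-lowered {a} {y} p with m≤n⇒m<n∨m≡n (a≤n p)
  ... | inj₂ refl = inj₂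
    ( onBorder ≤-refl (≤-trans (below p) (H′≤H ≤-refl)) (λ lt → contradiction lt (n≮n _))
    , f′-off λ (a≡m , _) → <⇒≢ (n<1+n m) (sym a≡m))
  ... | inj₁ a<sm with m≤n⇒m<n∨m≡n (s≤s⁻¹ a<sm)
  ...   | inj₁ a<m = inj₂
    ( onBorder (<⇒≤ a<sm) (≤-trans (below p) (H′≤H (<⇒≤ a<sm))) (λ lt → ≤-trans (≤-reflexive (sym (H′≡ a<m))) (above p lt))
    , f′-off λ (a≡m , _) → <⇒≢ a<m a≡m)
  ...   | inj₂ refl with m≤n⇒m<n∨m≡n (≤-trans (≤-reflexive (sym H′-last)) (above p (n<1+n m)))
  ...     | inj₂ refl = inj₁ (refl , refl)
  ...     | inj₁ h<y  = inj₂
    ( onBorder (n≤1+n m) (≤-trans (below p) (H′≤H (n≤1+n m))) (λ _ → ≤-trans (≤-reflexive h≡) h<y)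
    , f′-off λ (_ , y≡h) → <⇒≢ h<y (sym y≡h))

  to-lowered : OnBorder (suc m) H a y →
               (a ≡ suc m × y ≡ suc h) ⊎ (OnBorder (suc m) H′ a y × f′ a y ≡ f a y)
  to-lowered {a} {y} p with m≤n⇒m<n∨m≡n (a≤n p)
  ... | inj₁ a<sm = inj₂
    ( onBorder (a≤n p) (≤-trans (below p) (≤-reflexive (sym (H′≡ (s≤s⁻¹ a<sm))))) (λ lt → ≤-trans (H′≤H lt) (above p lt))
    , f′-off λ { (refl , refl) → contradiction (above p a<sm) (<⇒≱ (b<H ≤-refl)) })
  ... | inj₂ refl with m≤n⇒m<n∨m≡n (≤-trans (below p) (≤-reflexive h≡))
  ...   | inj₂ refl = inj₁ (refl , refl)
  ...   | inj₁ y<sh = inj₂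
    ( onBorder ≤-refl (≤-trans (s≤s⁻¹ y<sh) (≤-reflexive (sym H′-last))) (λ lt → contradiction lt (n≮n _))
    , f′-off λ (sm≡m , _) → <⇒≢ (n<1+n m) (sym sm≡m))

  -- As the last column has height at least two, `V₁` lies beyond the antidiagonal x + y = `suc m`,
  -- where border values are positive.
  1≤V₁ : 1 ≤ f m (suc h)
  1≤V₁ = n≢0⇒n>0 λ V₁≡0 → <⇒≱
    (subst (_≤ m + suc h) (trans (+-suc m 1) (cong suc (+-comm m 1))) (+-monoʳ-≤ m (s≤s (s≤s z≤n))))
    (zero⇒antidiagonal sh cs V₁ V₁≡0)

  -- The value grows by at most one from `V₁` to `V`, whose value is that of `V₂`, and from `V₃` to
  -- `V₂`; this bounds both terms of the minimum.
  V₂≤1+V₀ : f (suc m) h ≤ suc V₀-value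
  V₂≤1+V₀ = ⊓-glb (≤-trans (≤-reflexive V₂≡V) (slow (right V₁ V))) (slow (up V₃ V₂))

  conditions′ : Conditions (suc m) (OnBorder (suc m) H′) (InColumn H′) _≤_ f′
  conditions′ = record
    { start = trans (f′-off λ (_ , sm≡h) → <⇒≢ (subst (h <_) top (b<H z≤n)) (sym sm≡h)) start
    ; end   = trans (f′-off λ (sm≡m , _) → <⇒≢ (n<1+n m) (sym sm≡m)) end
    ; right = right′ ; up = up′ ; diag = diag′ }
    where
    right′ : OnBorder (suc m) H′ a y → OnBorder (suc m) H′ (suc a) y → Grows (f′ a y) (f′ (suc a) y)
    right′ p q with from-lowered p | from-lowered q
    ... | inj₁ (refl , refl) | inj₁ (sm≡m , _) = contradiction (sym sm≡m) (<⇒≢ (n<1+n m))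
    ... | inj₁ (refl , refl) | inj₂ (_ , eq) = subst₂ Grows (sym f′-V₀) (sym eq)
          (grows (≤-trans (m⊓n≤m _ _) V₁≤V₂) V₂≤1+V₀ (≤-trans 1≤V₁ V₁≤V₂))
    ... | inj₂ _ | inj₁ (refl , refl) =
      contradiction (≤-trans (≤-reflexive (sym (H′≡ ≤-refl))) (above p (m≤n⇒m≤1+n ≤-refl))) (<⇒≱ (b<H (n≤1+n m)))
    ... | inj₂ (p′ , ep) | inj₂ (q′ , eq) = subst₂ Grows (sym ep) (sym eq) (right p′ q′)

    up′ : OnBorder (suc m) H′ a y → OnBorder (suc m) H′ a (suc y) → Grows (f′ a y) (f′ a (suc y))
    up′ p q with from-lowered p | from-lowered q
    ... | inj₁ (refl , refl) | inj₁ (_ , sh≡h) = contradiction (sym sh≡h) (<⇒≢ (n<1+n h))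
    ... | inj₁ (refl , refl) | inj₂ (_ , eq) = subst₂ Grows (sym f′-V₀) (sym eq)
          (grows (m⊓n≤m _ _) (≤-trans V₁≤V₂ V₂≤1+V₀) 1≤V₁)
    ... | inj₂ _ | inj₁ (refl , refl) =
      contradiction (≤-trans (≤-reflexive (sym H′-last)) (above p (n<1+n m))) (<⇒≱ (n<1+n c))
    ... | inj₂ (p′ , ep) | inj₂ (q′ , eq) = subst₂ Grows (sym ep) (sym eq) (up p′ q′)

    diag′ : ∀ {a y a′ z} d → y ≡ z + d → a′ ≡ a + d → OnBorder (suc m) H′ a y → OnBorder (suc m) H′ a′ z →
            (∀ t u → suc (t + u) ≡ d → z + u < H′ (suc (a + t))) → f′ a y ≤ f′ a′ z
    diag′ {a} {_} {_} {z} zero refl refl _ _ _ =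
      ≤-reflexive (cong₂ f′ (sym (+-identityʳ a)) (+-identityʳ z))
    diag′ {a} {y} {a′} {z} (suc r) y≡ a′≡ p q inside with from-lowered p | from-lowered q
    ... | inj₁ (refl , refl) | inj₁ (refl , _) = contradiction (trans a′≡ (+-suc m r)) (<⇒≢ (s≤s (m≤m+n m r)))
    ... | inj₁ (refl , refl) | inj₂ (_ , eq) = V₀-right r y≡ a′≡ (a≤n q) eq
      where
      V₀-right : ∀ {a′ z} r → h ≡ z + suc r → a′ ≡ m + suc r → a′ ≤ suc m → f′ a′ z ≡ f a′ z → f′ m h ≤ f′ a′ z
      -- Only column `m` lies to the right of V₀, so the diagonal has one square and ends at `V₃`,
      -- whose value is the second term of the minimum.
      V₀-right {z = z} zero b≡ refl a′≤ eq with refl ← suc-injective (trans b≡ (+-comm z 1)) = begin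
        f′ m h        ≡⟨ f′-V₀ ⟩
        V₀-value      ≤⟨ m⊓n≤n (f m (suc h)) _ ⟩
        f (suc m) c   ≡⟨ cong (λ x → f x c) (+-comm 1 m) ⟩
        f (m + 1) c   ≡⟨ eq ⟨
        f′ (m + 1) c  ∎
        where open ≤-Reasoning
      V₀-right (suc r) b≡ refl a′≤ eq =
        contradiction a′≤ (<⇒≱ (subst (suc m <_) (sym (trans (+-suc m (suc r)) (cong suc (+-suc m r)))) (s≤s (s≤s (m≤m+n m r)))))
    -- For a diagonal ending at V₀ both terms of the minimum are bounds: the one at `V₁` by
    -- `left-of-corner`, the one at `V₃` by prolonging the diagonal by one square.
    ... | inj₂ (p′ , ep) | inj₁ (refl , refl) = subst₂ _≤_ (sym ep) (sym f′-V₀)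
          (⊓-glb (subst (λ w → f a w ≤ f m (suc h)) (sym y≡)
                   (left-of-corner sh cs r V₁ (subst (OnBorder (suc m) H a) y≡ p′) a′≡ inside′))
                 (diag (suc (suc r)) (trans y≡ (sym (+-suc c (suc r)))) (trans (cong suc a′≡) (sym (+-suc a (suc r)))) p′ V₃ longer))
      where
      inside′ : ∀ t u → suc (t + u) ≡ suc r → h + u < H (suc (a + t))
      inside′ t u e = ≤-trans (inside t u e) (H′≤H (s≤s (≤-trans
        (+-monoʳ-≤ a (≤-trans (m≤m+n t u) (≤-trans (n≤1+n _) (≤-reflexive e)))) (≤-reflexive (sym a′≡)))))
      longer : ∀ t u → suc (t + u) ≡ suc (suc r) → c + u < H (suc (a + t))
      longer t zero e = ≤-<-trans (≤-trans (≤-reflexive (+-identityʳ c)) (n≤1+n c))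
        (b<H (s≤s (≤-reflexive (trans (cong (a +_) (trans (sym (+-identityʳ t)) (suc-injective e))) (sym a′≡)))))
      longer t (suc u) e = subst (_< H (suc (a + t))) (sym (+-suc c u)) (inside′ t u (trans (sym (+-suc t u)) (suc-injective e)))
    ... | inj₂ (p′ , ep) | inj₂ (q′ , eq) = subst₂ _≤_ (sym ep) (sym eq)
          (diag (suc r) y≡ a′≡ p′ q′ λ t u e → ≤-trans (inside t u e)
            (H′≤H (≤-trans (subst (_≤ a + suc r) (+-suc a t) (+-monoʳ-≤ a (≤-trans (s≤s (m≤m+n t u)) (≤-reflexive e))))
              (≤-trans (≤-reflexive (sym a′≡)) (a≤n q)))))

  module _ (R : Realisation (suc m) H′ f′) where
    open Realisation R renaming (permutes to pm′; no231 to av′; realises to real′)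
    open Permutes pm′

    permutes′ : Permutes (suc m) H π ρ
    permutes′ = record { fits = λ i<sm → <-≤-trans (fits i<sm) (H′≤H i<sm) ; ρ< = ρ< ; πρ = πρ ; ρπ = ρπ }

    πm<h : π m < h
    πm<h = <-≤-trans (fits (n<1+n m)) (≤-reflexive H′-last)

    kept : OnBorder (suc m) H a y → ¬ (a ≡ suc m × y ≡ suc h) → Longest π a y (f a y)
    kept {a} {y} p off with to-lowered p
    ... | inj₁ at       = contradiction at off
    ... | inj₂ (q , eq) = subst (Longest π a y) eq (real′ q)

    longest-V₀ : Longest π m h V₀-value
    longest-V₀ = subst (Longest π m h) f′-V₀ (real′ (onBorder (n≤1+n m)
      (≤-trans (<⇒≤ (b<H (n≤1+n m))) (≤-reflexive (sym (H′≡ ≤-refl)))) λ _ → ≤-reflexive H′-last))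

    longest-V₁ : Longest π m (suc h) (f m (suc h))
    longest-V₁ = kept V₁ λ (m≡sm , _) → <⇒≢ (n<1+n m) m≡sm

    longest-V₂ : Longest π (suc m) h (f (suc m) h)
    longest-V₂ = kept V₂ λ (_ , h≡sh) → <⇒≢ (n<1+n h) h≡sh

    longest-V₃ : Longest π (suc m) c (f (suc m) c)
    longest-V₃ = kept V₃ λ (_ , c≡sh) → <⇒≢ (m≤n⇒m≤1+n (n<1+n c)) c≡sh

    -- A chain in R(V) misses the marker of column m or that of row b, since
    -- these two are decreasing.
    longest-V : Longest π (suc m) (suc h) (f (suc m) (suc h))
    longest-V = subst (Longest π (suc m) (suc h)) V₂≡V
      (widen ≤-refl (n≤1+n h) (proj₁ longest-V₂) , too-long)
      where
      too-long : ¬ Chain π (suc m) (suc h) (suc (f (suc m) h))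
      too-long (snoc i i<sm πi<sh ch) with m≤n⇒m<n∨m≡n (s≤s⁻¹ πi<sh)
      ... | inj₁ πi<h = proj₂ longest-V₂ (snoc i i<sm πi<h ch)
      ... | inj₂ πi≡h with m≤n⇒m<n∨m≡n (s≤s⁻¹ i<sm)
      ...   | inj₁ i<m  = proj₂ longest-V₁ (shorten (s≤s V₁≤V₂) (snoc i i<m πi<sh ch))
      ...   | inj₂ refl = <⇒≢ πm<h πi≡h

    realises″ : Realises (suc m) H π f
    realises″ p with to-lowered p
    ... | inj₁ (refl , refl) = longest-V
    ... | inj₂ (q , eq)      = subst (Longest π _ _) eq (real′ q)

    -- A 231 created by putting back the square below and to the left of V
    -- uses the marker (j , h) of row h as its 3 and that of column m as its 1.
    module _ {i j} (i<j : i < j) (j<m : j < m) (πm<πi : π m < π i) (πi<πj : π i < π j) (πj≡h : π j ≡ h) where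

      private
        joint : ∀ {q} → q < m → h < H′ (suc q)
        joint q<m = subst (h <_) (sym (H′≡ q<m)) (b<H (s≤s (<⇒≤ q<m)))

        extend : ∀ {q} → q < j → π q < h → Chain π q (π q) l → Chain π m (suc h) (suc (suc l))
        extend {q = q} q<j πq<h ch = snoc j j<m (s≤s (≤-reflexive πj≡h)) (snoc q q<j (subst (π q <_) (sym πj≡h) πq<h) ch)

        right-of-j : ∀ {q} → q < m → π q < h → ¬ q < j → j < q
        right-of-j q<m πq<h q≮j = ≤∧≢⇒< (≮⇒≥ q≮j) λ { refl → <⇒≢ πq<h πj≡h }

        lower-right : ∀ {q} → j < q → q < m → ¬ π q < π i
        lower-right j<q q<m πq<πi = <⇒≱ (joint q<m)
          (≤-trans (av′ i<j j<q (m≤n⇒m≤1+n q<m) πq<πi πi<πj) (≤-reflexive πj≡h))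

        -- The last marker q of a longest chain in R(V₀) lies to the right of j,
        -- by the value at V₁; then i , j , q or i , q , m is a 231.
        high-V₀ : ¬ V₀-value ≡ f (suc m) h
        high-V₀ eq with f (suc m) h | ≤-trans 1≤V₁ V₁≤V₂ | subst (Longest π m h) eq longest-V₀ | V₁≤V₂
        ... | suc s | _ | snoc q q<m πq<h ch , _ | V₁≤ with q <? j
        ...   | yes q<j = proj₂ longest-V₁ (shorten (s≤s V₁≤) (extend q<j πq<h ch))
        ...   | no  q≮j with <-cmp (π q) (π i) | right-of-j q<m πq<h q≮j
        ...     | tri< πq<πi _ _ | j<q = lower-right j<q q<m πq<πi
        ...     | tri≈ _ πq≡πi _ | j<q = <⇒≢ (<-trans i<j j<q)
                    (sym (injective (m≤n⇒m≤1+n q<m) (m≤n⇒m≤1+n (<-trans i<j j<m)) πq≡πi))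
        ...     | tri> _ _ πi<πq | j<q = <⇒≱ πq<h
                    (≤-trans (≤-reflexive (sym H′-last)) (av′ (<-trans i<j j<q) q<m (n<1+n m) πm<πi πi<πq))

        -- A longest chain in the rectangle of `V₂` is too long for that of V₀, so its last marker
        -- is the one in column `m`.
        chain-to-m : f (suc m) h ≡ suc V₀-value → Chain π m (π m) V₀-value
        chain-to-m eq with snoc q q<sm πq<h ch ← subst (Chain π (suc m) h) eq (proj₁ longest-V₂)
                      with m≤n⇒m<n∨m≡n (s≤s⁻¹ q<sm)
        ... | inj₁ q<m  = contradiction (snoc q q<m πq<h ch) (proj₂ longest-V₀)
        ... | inj₂ refl = ch

        -- Let `q` be the last marker of the chain. If `q` is left of `j`, adding `j` gives a chain
        -- too long for `V₁`. Otherwise `i`, `j`, `q` is a 231 in the lowered board, since `q` is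
        -- below the marker of `m`, which is below that of `i`.
        value-of-V₁ : V₀-value ≡ f m (suc h) → ¬ Chain π m (π m) V₀-value
        value-of-V₁ eq ch with f m (suc h) | 1≤V₁ | subst (Chain π m (π m)) eq ch | proj₂ longest-V₁
        ... | suc s | _ | snoc q q<m πq<πm ch′ | ¬longer with q <? j | <-trans πq<πm πm<h
        ...   | yes q<j | πq<h = ¬longer (extend q<j πq<h ch′)
        ...   | no  q≮j | πq<h = lower-right (right-of-j q<m πq<h q≮j) q<m (<-trans πq<πm πm<πi)

        -- A marker of column `m` below row `c` would prolong the chain to one too long for `V₃`. If
        -- it is in row `c`, no height is left for the marker of `i` strictly between `c` and `h`.
        value-of-V₃ : V₀-value ≡ f (suc m) c → ¬ Chain π m (π m) V₀-value
        value-of-V₃ eq ch with m≤n⇒m<n∨m≡n (s≤s⁻¹ πm<h)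
        ... | inj₁ πm<c = proj₂ longest-V₃ (snoc m (n<1+n m) πm<c (subst (Chain π m (π m)) eq ch))
        ... | inj₂ πm≡c = <⇒≱ (subst (π i <_) πj≡h πi<πj) (subst (_< π i) πm≡c πm<πi)

      -- The value at `V₂` is that at V₀ or one more, and in the second case the minimum at V₀ is
      -- attained at `V₁` or at `V₃`; each alternative has been refuted.
      no-new-231 : ∀ {A : Set} → A
      no-new-231 with m≤n⇒m<n∨m≡n V₂≤1+V₀
      ... | inj₁ V₂≤V₀ = contradiction (≤-antisym (≤-trans (m⊓n≤m _ _) V₁≤V₂) (s≤s⁻¹ V₂≤V₀)) high-V₀
      ... | inj₂ V₂≡ with ⊓-sel (f m (suc h)) (f (suc m) c)
      ...   | inj₁ eq = contradiction (chain-to-m V₂≡) (value-of-V₁ eq)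
      ...   | inj₂ eq = contradiction (chain-to-m V₂≡) (value-of-V₃ eq)

    no231″ : No231 (suc m) H π
    no231″ {i} {j} {k} i<j j<k k<sm πk<πi πi<πj with m≤n⇒m<n∨m≡n (s≤s⁻¹ k<sm)
    ... | inj₁ k<m  = ≤-trans (≤-reflexive (sym (H′≡ k<m))) (av′ i<j j<k k<sm πk<πi πi<πj)
    ... | inj₂ refl with m≤n⇒m<n∨m≡n (≤-trans (≤-reflexive (sym H′-last)) (av′ i<j j<k k<sm πk<πi πi<πj))
    ...   | inj₁ h<πj = ≤-trans (≤-reflexive h≡) h<πj
    ...   | inj₂ h≡πj = no-new-231 i<j j<k πk<πi πi<πj (sym h≡πj)

    realisation : Realisation (suc m) H f
    realisation = record { permutes = permutes′ ; no231 = no231″ ; realises = realises″ }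

-- Induction on the size of the board and on the height of its last column.

Realisable : ℕ → Set
Realisable n = ∀ {H f} → Shape n H → Conditions n (OnBorder n H) (InColumn H) _≤_ f → Realisation n H f

RealisableWithLast : ℕ → ℕ → Set
RealisableWithLast m h = ∀ {H f} → H (suc m) ≡ h → Shape (suc m) H →
  Conditions (suc m) (OnBorder (suc m) H) (InColumn H) _≤_ f → Realisation (suc m) H f

-- `Delete` passes to the board of size `m`, `Lower` to a last column that is lower by one.
realisable-step : ∀ {m} c → Realisable m → RealisableWithLast m (suc c) → RealisableWithLast m (suc (suc c))
realisable-step {m} c smaller lower {f = f} h≡ sh cs with f (suc m) (suc c) <? f (suc m) (suc (suc c))
... | yes V₂<V = Delete.realisation sh h≡ cs V₂<V (smaller shape′ conditions′)
  where open Delete sh h≡ cs V₂<V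
... | no  V₂≮V = Lower.realisation sh h≡ cs V₂≡V (lower H′-last shape′ conditions′)
  where
  open Conditions cs
  open LastCorner sh h≡ cs
  V₂≡V : f (suc m) (suc c) ≡ f (suc m) (suc (suc c))
  V₂≡V = ≤-antisym (mono (up V₂ V)) (≮⇒≥ V₂≮V)
  open Lower sh h≡ cs V₂≡V

realisable-with-last : ∀ {m} → Realisable m → ∀ h → RealisableWithLast m h
-- An empty last column would make the border end with a step to the right at height 0, whose right
-- end has positive value, against `end`.
realisable-with-last {m} smaller zero h≡ sh cs =
  contradiction (≤-trans (pos (right V V′)) (≤-reflexive end)) λ ()
  where
  open Conditions cs
  V : OnBorder (suc m) _ m 0
  V = onBorder (n≤1+n m) z≤n λ _ → ≤-reflexive h≡
  V′ : OnBorder (suc m) _ (suc m) 0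
  V′ = onBorder ≤-refl z≤n λ lt → contradiction lt (n≮n _)
-- Here `V₂` is the end of the border, with value 0, while the value at `V` is positive, so the drop
-- is automatic.
realisable-with-last {m} smaller (suc zero) {f = f} h≡ sh cs =
  Delete.realisation sh h≡ cs V₂<V (smaller shape′ conditions′)
  where
  open Conditions cs
  open LastCorner sh h≡ cs
  V₂<V : f (suc m) 0 < f (suc m) 1
  V₂<V = subst (_< f (suc m) 1) (sym end) (pos (right V₁ V))
  open Delete sh h≡ cs V₂<V
realisable-with-last smaller (suc (suc c)) =
  realisable-step c smaller (realisable-with-last smaller (suc c))

realisable : ∀ n → Realisable n
realisable zero {f = f} sh cs = record
  { π = id ; ρ = id
  ; permutes = record { fits = λ () ; ρ< = λ () ; πρ = λ () ; ρπ = λ () }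
  ; no231    = λ { _ _ () }
  ; realises = λ p → subst₂ (λ a b → Longest id a b (f a b)) (sym (n≤0⇒n≡0 (a≤n p)))
      (sym (n≤0⇒n≡0 (≤-trans (below p) (≤-trans (Shape.anti sh z≤n (a≤n p)) (≤-reflexive (Shape.top sh))))))
      (subst (Longest id 0 0) (sym (Conditions.start cs)) ([] , λ { (snoc _ () _ _) })) }
realisable (suc m) sh cs = realisable-with-last (realisable m) _ refl sh cs

-- Reflection

conditions-map : (∀ {a b} → On′ a b → On a b) → (∀ {i j} → Cell i j → Cell′ i j) →
                 Conditions n On Cell′ _∼_ f → Conditions n On′ Cell _∼_ f
conditions-map on cell cs = record
  { start = start ; end = end
  ; right = λ p q → right (on p) (on q)
  ; up    = λ p q → up (on p) (on q)
  ; diag  = λ d e e′ p q inside → diag d e e′ (on p) (on q) λ t u eq → cell (inside t u eq)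
  } where open Conditions cs

-- Reflection exchanges the two ends of each diagonal and so reverses the relation, which turns the
-- 312-conditions of a board into the 231-conditions of its reflection.
conditions-transpose : Conditions n On Cell _∼_ f →
                       Conditions n (flip On) (flip Cell) (flip _∼_) (flip f)
conditions-transpose cs = record
  { start = end ; end = start ; right = up ; up = right
  ; diag  = λ d e e′ p q inside → diag d e′ e q p
              λ t u eq → inside u t (trans (cong suc (+-comm u t)) eq)
  } where open Conditions cs

-- The column heights of a board and its row lengths describe the same squares, up to a flip; all
-- comparisons between the two go through these squares.
record Diagram (n : ℕ) (Cell : ℕ → ℕ → Set) (H : ℕ → ℕ) : Set where
  field
    shape : Shape n H
    cell  : j < H (suc i) ⇔ Cell i j

module _ (D : Diagram n Cell H) (E : Diagram n (flip Cell) K) where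
  private
    module D = Diagram D
    module E = Diagram E
    module DS = Shape D.shape
    module ES = Shape E.shape

  onBorder-transpose : OnBorder n H a b → OnBorder n K b a
  onBorder-transpose {a} {b} p = onBorder b≤n (left a b p b≤n) outside
    where
    b≤n : b ≤ n
    b≤n = ≤-trans (below p) (≤-trans (DS.anti z≤n (a≤n p)) (≤-reflexive DS.top))
    left : ∀ a b → OnBorder n H a b → b ≤ n → a ≤ K b
    left zero    b       p b≤n = z≤n
    left (suc a) zero    p b≤n = ≤-trans (a≤n p) (≤-reflexive (sym ES.top))
    left (suc a) (suc b) p b≤n = from E.cell (to D.cell (below p))
    outside : b < n → K (suc b) ≤ a
    outside b<n with m≤n⇒m<n∨m≡n (a≤n p)
    ... | inj₁ a<n  = ≮⇒≥ λ lt → <⇒≱ (from D.cell (to E.cell lt)) (above p a<n)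
    ... | inj₂ refl = ≤-trans (ES.anti z≤n b<n) (≤-reflexive ES.top)

permutes-transpose : ∀ {π ρ} → Diagram n Cell H → Diagram n (flip Cell) K →
                     Permutes n H π ρ → Permutes n K ρ π
permutes-transpose {n = n} {H = H} {K = K} {π} {ρ} D E pm = record
  { fits = λ {j} j<n → from (Diagram.cell E) (to (Diagram.cell D) (subst (_< H (suc (ρ j))) (πρ j<n) (fits (ρ< j<n))))
  ; ρ<   = λ i<n → <-≤-trans (fits i<n) (≤-trans (Shape.anti (Diagram.shape D) z≤n i<n) (≤-reflexive (Shape.top (Diagram.shape D))))
  ; πρ   = ρπ ; ρπ = πρ }
  where open Permutes pm

chain-transpose : ∀ {π ρ} → Permutes n H π ρ → a ≤ n → Chain π a b l → Chain ρ b a l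
chain-transpose pm _ [] = []
chain-transpose {π = π} {ρ} pm a≤n (snoc i i<a πi<b ch) =
  snoc (π i) πi<b (subst (_< _) (sym ρπi) i<a)
    (subst (λ z → Chain ρ (π i) z _) (sym ρπi) (chain-transpose pm (<⇒≤ i<n) ch))
  where
  i<n = <-≤-trans i<a a≤n
  ρπi = Permutes.ρπ pm i<n

realises-transpose : ∀ {π ρ} → Diagram n Cell H → Diagram n (flip Cell) K → Permutes n H π ρ →
                     Realises n H π f → Realises n K ρ (flip f)
realises-transpose D E pm real {b} {a} q =
  chain-transpose pm (a≤n p) (proj₁ (real p)) ,
  proj₂ (real p) ∘ chain-transpose (permutes-transpose D E pm) (a≤n q)
  where p = onBorder-transpose E D q

-- The border of a Ferrers board

-- A downward closed predicate holds on an initial segment, whose length is the count; this turns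
-- column and row lengths into membership in the board.
count-downset : ∀ (p : ℕ → Bool) g m → (∀ {i j} → i ≤ j → T (p (g j)) → T (p (g i))) →
                j < length (filterᵇ p (applyUpTo g m)) ⇔ (T (p (g j)) × j < m)
count-downset p g m down = mk⇔ (fwd m g down) (bwd m g down)
  where
  fwd : ∀ {j} m g → (∀ {i j} → i ≤ j → T (p (g j)) → T (p (g i))) →
        j < length (filterᵇ p (applyUpTo g m)) → T (p (g j)) × j < m
  fwd {j} (suc m) g down lt with p (g 0) in eq
  fwd {zero}  (suc m) g down lt       | true  = subst T (sym eq) _ , z<s
  fwd {suc j} (suc m) g down (s≤s lt) | true  =
    let q , j<m = fwd m (g ∘ suc) (down ∘ s≤s) lt in q , s<s j<m
  fwd {j}     (suc m) g down lt       | false =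
    contradiction (subst T eq (down z≤n (proj₁ (fwd m (g ∘ suc) (down ∘ s≤s) lt)))) λ ()

  bwd : ∀ {j} m g → (∀ {i j} → i ≤ j → T (p (g j)) → T (p (g i))) →
        T (p (g j)) × j < m → j < length (filterᵇ p (applyUpTo g m))
  bwd {j} (suc m) g down (q , j<sm) with p (g 0) in eq
  bwd {zero}  (suc m) g down (q , _)       | true  = z<s
  bwd {suc j} (suc m) g down (q , s≤s j<m) | true  = s<s (bwd m (g ∘ suc) (down ∘ s≤s) (q , j<m))
  bwd {j}     (suc m) g down (q , _)       | false = contradiction (subst T eq (down z≤n q)) λ ()

maximum-antitone : ∀ (g : ℕ → ℕ) m → (∀ i → g i ≤ g 0) → (m ≡ 0 → g 0 ≡ 0) →
                   foldr _⊔_ 0 (map g (upTo m)) ≡ g 0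
maximum-antitone g zero    anti empty = sym (empty refl)
maximum-antitone g (suc m) anti empty = m≥n⇒m⊔n≡m (bounded suc m)
  where
  bounded : ∀ h m → foldr _⊔_ 0 (map g (applyUpTo h m)) ≤ g 0
  bounded h zero    = z≤n
  bounded h (suc m) = ⊔-lub (anti (h 0)) (bounded (h ∘ suc) m)

-- Prepends the size, in line with the convention for `H 0` in `Shape`.
withTop : ℕ → (ℕ → ℕ) → ℕ → ℕ
withTop n g zero    = n
withTop n g (suc i) = g i

diagram : ∀ {g} → g 0 ≡ n → (∀ {i j} → j < g i ⇔ Cell i j) →
          (∀ {i i′ j} → i ≤ i′ → Cell i′ j → Cell i j) → Diagram n Cell (withTop n g)
diagram {n} {Cell} {g} top cell left = record
  { shape = record { top = refl ; anti = λ i≤j _ → anti i≤j } ; cell = cell }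
  where
  antitone : i ≤ j → g j ≤ g i
  antitone i≤j = ≮⇒≥ λ lt → n≮n _ (from cell (left i≤j (to cell lt)))
  anti : i ≤ j → withTop n g j ≤ withTop n g i
  anti {zero}  {zero}  _         = ≤-refl
  anti {zero}  {suc j} _         = ≤-trans (antitone z≤n) (≤-reflexive top)
  anti {suc i} {suc j} (s≤s i≤j) = antitone i≤j

module Geometry (F : FerrersBoard) (square : longestRow F ≡ longestColumn F) where

  size : ℕ
  size = longestColumn F

  InF : ℕ → ℕ → Set
  InF i j = (i , j) ∈ squares F

  closed-down : ∀ {i′ j′} → i ≤ i′ → j ≤ j′ → InF i′ j′ → InF i j
  closed-down i≤ j≤ p = closed F _ (_ , p , topRight) _ (s≤s i≤ , s≤s j≤)

  column : j < columnLength F i ⇔ InF i j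
  column {j} {i} = mk⇔ (proj₁ ∘ to count) λ p → from count (p , proj₂ (inArray F _ p))
    where count = count-downset (λ j → squares F (i , j)) id (FerrersBoard.m F) (closed-down ≤-refl)

  row : i < rowLength F j ⇔ InF i j
  row {i} {j} = mk⇔ (proj₁ ∘ to count) λ p → from count (p , proj₁ (inArray F _ p))
    where count = count-downset (λ i → squares F (i , j)) id (FerrersBoard.m F) (λ i≤ → closed-down i≤ ≤-refl)

  firstColumn : columnLength F 0 ≡ size
  firstColumn = sym (maximum-antitone (columnLength F) (FerrersBoard.m F)
    (λ i → ≮⇒≥ λ lt → n≮n _ (from column (closed-down z≤n ≤-refl (to column lt))))
    λ m≡0 → cong (λ m → length (filterᵇ (λ j → squares F (0 , j)) (upTo m))) m≡0)

  firstRow : rowLength F 0 ≡ size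
  firstRow = trans (sym (maximum-antitone (rowLength F) (FerrersBoard.m F)
    (λ j → ≮⇒≥ λ lt → n≮n _ (from row (closed-down ≤-refl z≤n (to row lt))))
    λ m≡0 → cong (λ m → length (filterᵇ (λ i → squares F (i , 0)) (upTo m))) m≡0)) square

  columns rows : ℕ → ℕ
  columns = withTop size (columnLength F)
  rows    = withTop size (rowLength F)

  columnDiagram : Diagram size InF columns
  columnDiagram = diagram firstColumn column λ i≤ → closed-down i≤ ≤-refl

  rowDiagram : Diagram size (flip InF) rows
  rowDiagram = diagram firstRow row λ j≤ → closed-down ≤-refl j≤

  open Shape (Diagram.shape columnDiagram)

  bottomRow : i < size → InF i 0
  bottomRow i<n = to row (<-≤-trans i<n (≤-reflexive (sym firstRow)))

  leftColumn : j < size → InF 0 j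
  leftColumn j<n = to column (<-≤-trans j<n (≤-reflexive (sym firstColumn)))

  inF⇒i<n : InF i j → i < size
  inF⇒i<n p = <-≤-trans (from row (closed-down ≤-refl z≤n p)) (≤-reflexive firstRow)

  inF⇒j<n : InF i j → j < size
  inF⇒j<n p = <-≤-trans (from column (closed-down z≤n ≤-refl p)) (≤-reflexive firstColumn)

  Border : ℕ → ℕ → Set
  Border = OnBorder size columns

  b≤n : Border a b → b ≤ size
  b≤n p = ≤-trans (below p) (anti z≤n (a≤n p))

  -- The vertex (a , b) of the border is its entry of index a + (size - b).
  record At (k : ℕ) (V : Vertex) : Set where
    constructor at
    field
      border-vertex : Border (proj₁ V) (proj₂ V)
      index         : proj₁ V + size ≡ k + proj₂ V

  open At

  at-resp : ∀ {V} → k ≡ l → At k V → At l V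
  at-resp refl p = p

  -- Of two vertices with the same index the one further right would be higher, but the border never
  -- rises.
  at-leftmost : At k (a , b) → At k (a′ , b′) → ¬ a < a′
  at-leftmost {k} {a} {b} {a′} {b′} p q a<a′ = <⇒≱
    (+-cancelˡ-< k b b′ (subst₂ _<_ (index p) (index q) (+-monoˡ-< size a<a′)))
    (≤-trans (below (border-vertex q)) (≤-trans (anti a<a′ (a≤n (border-vertex q)))
      (above (border-vertex p) (<-≤-trans a<a′ (a≤n (border-vertex q))))))

  at-unique : ∀ {V W} → At k V → At k W → V ≡ W
  at-unique {k} {a , b} {a′ , b′} p q with <-cmp a a′
  ... | tri< a<a′ _ _ = contradiction a<a′ (at-leftmost p q)
  ... | tri≈ _ refl _ = cong (a ,_) (+-cancelˡ-≡ k b b′ (trans (sym (index p)) (index q)))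
  ... | tri> _ _ a′<a = contradiction a′<a (at-leftmost q p)

  at-step : ∀ {V} → At k V → k < size + size →
            At (suc k) (step F V) × (DirectlyLeftOf V (step F V) ⊎ DirectlyBelow (step F V) V)
  -- Height 0 occurs at the last index only: for `a < size` the square (`a` , 0) is in the board, so
  -- its lower left corner is not on the border.
  at-step {k} {a , zero} (at p eq) k<2n = contradiction (above p a<n) (<⇒≱ (from column (bottomRow a<n)))
    where
    a<n : a < size
    a<n = +-cancelʳ-< size a size (subst (_< size + size) (trans (sym (+-identityʳ k)) (sym eq)) k<2n)
  at-step {k} {a , suc b} (at p eq) k<2n with squares F (a , b) in inF
  ... | true =
    at (onBorder a<n (from column Fab) λ sa<n → ≤-trans (anti (n≤1+n (suc a)) sa<n) (above p a<n)) (cong suc eq) ,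
    inj₁ refl
    where
    Fab : InF a b
    Fab = subst T (sym inF) _
    a<n : a < size
    a<n = inF⇒i<n Fab
  ... | false =
    at (onBorder (a≤n p) (<⇒≤ (below p)) λ a<n → ≮⇒≥ λ lt → subst T inF (to column lt)) (trans eq (+-suc k b)) ,
    inj₂ refl

  at-start : At 0 (0 , size)
  at-start = at (onBorder z≤n ≤-refl (λ 0<n → anti {0} {1} z≤n 0<n)) refl

  at-iterate : ∀ N k V → At k V → k + N ≤ suc (size + size) →
               ∀ i → At (k + toℕ i) (lookup (Vec.iterate (step F) V N) i)
  at-iterate (suc N)       k V p le zero    = at-resp (sym (+-identityʳ k)) p
  at-iterate (suc (suc N)) k V p le (suc i) = at-resp (sym (+-suc k (toℕ i)))
      (at-iterate (suc N) (suc k) (step F V) (proj₁ (at-step p k<2n)) le′ i)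
    where
    le′ : suc k + suc N ≤ suc (size + size)
    le′ = subst (_≤ suc (size + size)) (+-suc k (suc N)) le
    k<2n : k < size + size
    k<2n = ≤-trans (s≤s (m≤m+n k N)) (subst (_≤ size + size) (+-suc k N) (s≤s⁻¹ le′))

  steps≡ : borderSteps F ≡ size + size
  steps≡ = cong (_+ size) square

  at-border : ∀ k → At (toℕ k) (lookup (border F) k)
  at-border k = at-iterate (suc (borderSteps F)) 0 (0 , size) at-start (s≤s (≤-reflexive steps≡)) k

  position : ℕ → ℕ → ℕ
  position a b = a + (size ∸ b)

  at-position : Border a b → At (position a b) (a , b)
  at-position {a} {b} p = at p (trans (cong (a +_) (sym (m∸n+n≡m (b≤n p)))) (sym (+-assoc a (size ∸ b) b)))

  index-of : Border a b → Fin (suc (borderSteps F))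
  index-of {a} {b} p = fromℕ< {position a b} (s≤s (≤-trans (+-mono-≤ (a≤n p) (m∸n≤m size b)) (≤-reflexive (sym steps≡))))

  lookup-index : (p : Border a b) → lookup (border F) (index-of p) ≡ (a , b)
  lookup-index p = at-unique (at-resp (toℕ-fromℕ< _) (at-border (index-of p))) (at-position p)

  -- A total lookup, with default 0 beyond the end; the positions of border vertices are in range.
  entry : ∀ {N} → Vec ℕ N → ℕ → ℕ
  entry []       _       = 0
  entry (x ∷ xs) zero    = x
  entry (x ∷ xs) (suc k) = entry xs k

  entry-toℕ : ∀ {N} (xs : Vec ℕ N) k → entry xs (toℕ k) ≡ lookup xs k
  entry-toℕ (x ∷ xs) zero    = refl
  entry-toℕ (x ∷ xs) (suc k) = entry-toℕ xs k

  module _ (S : FSequence F) where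

    value : ℕ → ℕ → ℕ
    value a b = entry S (position a b)

    value-lookup : ∀ k {a b} → At (toℕ k) (a , b) → value a b ≡ lookup S k
    value-lookup k {a} {b} p = trans
      (cong (entry S) (+-cancelʳ-≡ b _ _ (trans (sym (index (at-position (border-vertex p)))) (index p))))
      (entry-toℕ S k)

    value-border : ∀ k → value (proj₁ (lookup (border F) k)) (proj₂ (lookup (border F) k)) ≡ lookup S k
    value-border k = value-lookup k (at-border k)

    value-index : (p : Border a b) → lookup S (index-of p) ≡ value a b
    value-index p = sym (trans (cong (entry S) (sym (toℕ-fromℕ< _))) (entry-toℕ S (index-of p)))

    last-lookup : ∀ {N} (xs : Vec ℕ (suc N)) → Vec.last xs ≡ lookup xs (fromℕ N)
    last-lookup (x ∷ [])     = refl
    last-lookup (x ∷ y ∷ xs) = last-lookup (y ∷ xs)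

    at-end : At (size + size) (size , 0)
    at-end = at (onBorder ≤-refl z≤n λ lt → contradiction lt (n≮n size)) (sym (+-identityʳ (size + size)))

    value-end : value size 0 ≡ Vec.last S
    value-end = trans (value-lookup (fromℕ (borderSteps F))
        (at-resp (sym (trans (toℕ-fromℕ (borderSteps F)) steps≡)) at-end))
      (sym (last-lookup S))

    value-start : value 0 size ≡ Vec.head S
    value-start = trans (value-lookup zero at-start) (head-lookup S)
      where
      head-lookup : ∀ {N} (xs : Vec ℕ (suc N)) → lookup xs zero ≡ Vec.head xs
      head-lookup (x ∷ xs) = refl

    module _ (_∼_ : Rel ℕ 0ℓ) where

      FConditions : Set
      FConditions = Monotonicity F S × ZeroConditions F S × Diagonal F S _∼_

      abstractly : FConditions → Conditions size Border InF _∼_ value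
      abstractly (mono , (first , last , ¬zeros) , diagonal) = record
        { start = trans value-start first ; end = trans value-end last
        ; right = λ {a} {b} p q → grow {a} {b} {suc a} {b} p q
                    (inj₁ (subst₂ DirectlyLeftOf (sym (lookup-index p)) (sym (lookup-index q)) refl))
                    (inj₁ refl)
        ; up = λ {a} {b} p q → grow {a} {b} {a} {suc b} p q
                    (inj₂ (subst₂ DirectlyBelow (sym (lookup-index p)) (sym (lookup-index q)) refl))
                    (inj₂ (trans (sym (+-suc a _)) (cong (a +_) (sym (+-∸-assoc 1 (b≤n q))))))
        ; diag = λ { d refl refl p q inside → subst₂ _∼_ (value-index p) (value-index q)
                     (diagonal (index-of p) (index-of q)
                       (subst₂ (DiagonalWithin F) (sym (lookup-index p)) (sym (lookup-index q))
                         (d , refl , refl , inside))) }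
        }
        where
        not-both : ∀ {a b a′ b′} (p : Border a b) (q : Border a′ b′) → suc (position a b) ≡ position a′ b′ →
                   value a b ≡ 0 → value a′ b′ ≢ 0
        not-both {a} {b} p q eq zp zq = ¬zeros (earlier , trans (cong (lookup S) left) (trans (value-index p) zp)
                                                  , trans (cong (lookup S) right) (trans (value-index q) zq))
          where
          earlier : Fin (borderSteps F)
          earlier = fromℕ< {position a b} (s≤s⁻¹ (≤-trans
            (≤-reflexive (cong suc (trans eq (sym (toℕ-fromℕ< _))))) (toℕ<n (index-of q))))
          left : inject₁ earlier ≡ index-of p
          left = toℕ-injective (trans (toℕ-inject₁ earlier) (trans (toℕ-fromℕ< _) (sym (toℕ-fromℕ< _))))
          right : suc earlier ≡ index-of q
          right = toℕ-injective (trans (cong suc (toℕ-fromℕ< _)) (trans eq (sym (toℕ-fromℕ< _))))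

        -- A right neighbour follows on the border and an upper neighbour precedes, hence the
        -- alternative for the positions. If the larger value were 0, so would be the smaller,
        -- against the 0-condition for this pair.
        grow : ∀ {a b a′ b′} (p : Border a b) (q : Border a′ b′) →
               DirectlyLeftOf (lookup (border F) (index-of p)) (lookup (border F) (index-of q)) ⊎
               DirectlyBelow (lookup (border F) (index-of p)) (lookup (border F) (index-of q)) →
               (suc (position a b) ≡ position a′ b′) ⊎ (suc (position a′ b′) ≡ position a b) →
               Grows (value a b) (value a′ b′)
        grow {a} {b} {a′} {b′} p q next adjacent with le , slow ← mono (index-of p) (index-of q) next = grows p≤q
            (≤-trans (subst₂ _≤_ (value-index q) (cong (_+ 1) (value-index p)) slow) (≤-reflexive (+-comm _ 1)))
            (n≢0⇒n>0 λ q≡0 → both (n≤0⇒n≡0 (≤-trans p≤q (≤-reflexive q≡0))) q≡0)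
          where
          p≤q = subst₂ _≤_ (value-index p) (value-index q) le
          both : value a b ≡ 0 → value a′ b′ ≢ 0
          both zp zq = [ (λ eq → not-both p q eq zp zq) , (λ eq → not-both q p eq zq zp) ]′ adjacent

      concretely : Conditions size Border InF _∼_ value → FConditions
      concretely cs = mono′ , (trans (sym value-start) start , trans (sym value-end) end , λ (k , zk , zk′) → ¬zeros k zk zk′) , diagonal
        where
        open Conditions cs

        on : ∀ {V} k → lookup (border F) k ≡ V → Border (proj₁ V) (proj₂ V)
        on k refl = border-vertex (at-border k)

        is : ∀ {V} k → lookup (border F) k ≡ V → value (proj₁ V) (proj₂ V) ≡ lookup S k
        is k refl = value-border k

        concrete : ∀ {V W} p q → lookup (border F) p ≡ V → lookup (border F) q ≡ W →
                   Grows (value (proj₁ V) (proj₂ V)) (value (proj₁ W) (proj₂ W)) → Grows (lookup S p) (lookup S q)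
        concrete p q eq eq′ = subst₂ Grows (is p eq) (is q eq′)

        adjacent : ∀ p q → let V₁ = lookup (border F) p ; V₂ = lookup (border F) q in
                   DirectlyLeftOf V₁ V₂ ⊎ DirectlyBelow V₁ V₂ → Grows (lookup S p) (lookup S q)
        adjacent p q (inj₁ eq) = concrete p q refl eq (right (on p refl) (on q eq))
        adjacent p q (inj₂ eq) = concrete p q refl eq (up (on p refl) (on q eq))

        mono′ : Monotonicity F S
        mono′ p q next = mono g , ≤-trans (slow g) (≤-reflexive (+-comm 1 _))
          where g = adjacent p q next

        -- Consecutive vertices are joined by `step`, so the larger of their two values is positive.
        ¬zeros : ∀ k → lookup S (inject₁ k) ≡ 0 → lookup S (suc k) ≢ 0
        ¬zeros k zk zk′ =
          [ (λ eq → <⇒≢ (pos (adjacent (inject₁ k) (suc k) (inj₁ (trans next eq)))) (sym zk′))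
          , (λ eq → <⇒≢ (pos (adjacent (suc k) (inject₁ k)
              (inj₂ (trans eq (cong (λ V → proj₁ V , suc (proj₂ V)) (sym next)))))) (sym zk))
          ]′ (proj₂ stepped)
          where
          stepped = at-step (at-resp (toℕ-inject₁ k) (at-border (inject₁ k)))
                   (≤-trans (toℕ<n k) (≤-reflexive steps≡))
          next : lookup (border F) (suc k) ≡ step F (lookup (border F) (inject₁ k))
          next = at-unique (at-border (suc k)) (proj₁ stepped)

        diagonal : Diagonal F S _∼_
        diagonal p q (d , e , e′ , inside) = subst₂ _∼_ (value-border p) (value-border q)
          (diag d e e′ (on p refl) (on q refl) inside)

-- Patterns of length three

filterᵇ-none : ∀ (p : ℕ → Bool) g b → (∀ {j} → j < b → ¬ T (p (g j))) → filterᵇ p (applyUpTo g b) ≡ []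
filterᵇ-none p g b none = filter-none (T? ∘ p) (applyUpTo⁺₁ g b none)

filterᵇ-unique : ∀ (p : ℕ → Bool) g {v} b → (∀ {j} → T (p (g j)) → v ≡ j) → T (p (g v)) →
                 v < b → filterᵇ p (applyUpTo g b) ≡ g v ∷ []
filterᵇ-unique p g {zero} (suc b) unique pv v<b = trans (filter-accept (T? ∘ p) pv)
  (cong (g 0 ∷_) (filterᵇ-none p (g ∘ suc) b λ _ pj → contradiction (unique pj) λ ()))
filterᵇ-unique p g {suc v} (suc b) unique pv (s≤s v<b) =
  trans (filter-reject (T? ∘ p) (λ p0 → contradiction (unique p0) λ ()))
    (filterᵇ-unique p (g ∘ suc) b (suc-injective ∘ unique) pv v<b)

-- With the contribution of one column written as a filter, the whole restriction becomes a single
-- filter of the word of `π`.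
filterᵇ-singleton : ∀ (p : ℕ → Bool) {v} b → (∀ {j} → T (p j) ⇔ v ≡ j) →
                    filterᵇ p (upTo b) ≡ filter (_<? b) (v ∷ [])
filterᵇ-singleton p {v} b unique with v <? b
... | yes v<b = trans (filterᵇ-unique p id b (to unique) (from unique refl) v<b) (sym (filter-accept (_<? b) v<b))
... | no  v≮b = trans (filterᵇ-none p id b λ j<b pj → v≮b (subst (_< b) (sym (to unique pj)) j<b))
                  (sym (filter-reject (_<? b) v≮b))

-- `standardize xs` is `map (rank xs) xs`.
rank : List ℕ → ℕ → ℕ
rank xs x = length (filter (_≤? x) xs)

rank-counted : ∀ xs → z ≤ x → rank (z ∷ xs) x ≡ suc (rank xs x)
rank-counted xs z≤x = cong length (filter-accept (_≤? _) z≤x)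

rank-skipped : ∀ xs → ¬ z ≤ x → rank (z ∷ xs) x ≡ rank xs x
rank-skipped xs z≰x = cong length (filter-reject (_≤? _) z≰x)

rank≤rank-∷ : ∀ z xs → rank xs x ≤ rank (z ∷ xs) x
rank≤rank-∷ {x} z xs with z ≤? x
... | yes z≤x = ≤-trans (n≤1+n _) (≤-reflexive (sym (rank-counted xs z≤x)))
... | no  z≰x = ≤-reflexive (sym (rank-skipped xs z≰x))

rank-mono-≤ : ∀ xs → x ≤ y → rank xs x ≤ rank xs y
rank-mono-≤ [] _ = z≤n
rank-mono-≤ {x} {y} (z ∷ xs) x≤y with z ≤? x
... | yes z≤x = subst₂ _≤_ (sym (rank-counted xs z≤x)) (sym (rank-counted xs (≤-trans z≤x x≤y)))
                  (s≤s (rank-mono-≤ xs x≤y))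
... | no  z≰x = ≤-trans (≤-reflexive (rank-skipped xs z≰x))
                  (≤-trans (rank-mono-≤ xs x≤y) (rank≤rank-∷ z xs))

-- Strictness comes from `y` itself, which is counted in the rank of `y` but not in that of `x`.
rank-mono-< : y ∈ˡ xs → x < y → rank xs x < rank xs y
rank-mono-< {y} {_ ∷ xs} (here refl) x<y = subst₂ _<_ (sym (rank-skipped xs (<⇒≱ x<y))) (sym (rank-counted xs ≤-refl))
                                             (s≤s (rank-mono-≤ xs (<⇒≤ x<y)))
rank-mono-< {y} {z ∷ xs} {x} (there y∈) x<y with z ≤? x
... | yes z≤x = subst₂ _<_ (sym (rank-counted xs z≤x)) (sym (rank-counted xs (≤-trans z≤x (<⇒≤ x<y))))
                  (s≤s (rank-mono-< y∈ x<y))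
... | no  z≰x = ≤-trans (≤-reflexive (cong suc (rank-skipped xs z≰x)))
                  (≤-trans (rank-mono-< y∈ x<y) (rank≤rank-∷ z xs))

rank-cancel-< : rank xs x < rank xs y → x < y
rank-cancel-< {xs} lt = ≰⇒> λ y≤x → <⇒≱ lt (rank-mono-≤ xs y≤x)

⊆-map⁻ : ∀ (g : ℕ → ℕ) {ys} xs → ys ⊆ map g xs → ∃[ zs ] ys ≡ map g zs × zs ⊆ xs
⊆-map⁻ g []       []          = [] , refl , []
⊆-map⁻ g (x ∷ xs) (_ ∷ʳ sub)   = let zs , eq , sub′ = ⊆-map⁻ g xs sub in zs , eq , x ∷ʳ sub′
⊆-map⁻ g (x ∷ xs) (refl ∷ sub) = let zs , eq , sub′ = ⊆-map⁻ g xs sub in x ∷ zs , cong (g x ∷_) eq , refl ∷ sub′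

Ternary : Set₁
Ternary = ℕ → ℕ → ℕ → Set

Is231 Is312 : Ternary
Is231 x y z = z < x × x < y
Is312 x y z = y < z × z < x

-- The function `g` is to be `rank xs`. It is strictly increasing only when the larger argument is
-- an entry of `xs`, hence the membership in `preserved`; that it reflects the order holds
-- everywhere.
record Describes (τ : List ℕ) (R : Ternary) : Set where
  field
    three : length τ ≡ 3
    iso   : OrderIsomorphic (x ∷ y ∷ z ∷ []) τ ⇔ R x y z
    preserved : ∀ {g : ℕ → ℕ} → (∀ {u v} → v ∈ˡ (x ∷ y ∷ z ∷ []) → u < v → g u < g v) → R x y z → R (g x) (g y) (g z)
    reflected : ∀ {g : ℕ → ℕ} → (∀ {u v} → g u < g v → u < v) → R (g x) (g y) (g z) → R x y z

both-false : ∀ {u v u′ v′ : ℕ} → ¬ u < v → ¬ u′ < v′ → (u < v) ⇔ (u′ < v′)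
both-false p q = mk⇔ (λ r → contradiction r p) (λ r → contradiction r q)

both-true : ∀ {u v u′ v′ : ℕ} → u < v → u′ < v′ → (u < v) ⇔ (u′ < v′)
both-true p q = mk⇔ (λ _ → q) (λ _ → p)

describes231 : Describes τ231 Is231
describes231 = record
  { three = refl
  ; iso = mk⇔ (λ (_ , h) → from (h (suc (suc zero)) zero) (s≤s (s≤s z≤n)) , from (h zero (suc zero)) (s≤s (s≤s (s≤s z≤n))))
      λ (z<x , x<y) → refl , λ
        { zero zero → both-false (n≮n _) (n≮n _)
        ; zero (suc zero) → both-true x<y ≤-refl
        ; zero (suc (suc zero)) → both-false (<⇒≯ z<x) λ { (s≤s ()) }
        ; (suc zero) zero → both-false (<⇒≯ x<y) λ { (s≤s (s≤s ())) }
        ; (suc zero) (suc zero) → both-false (n≮n _) (n≮n _)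
        ; (suc zero) (suc (suc zero)) → both-false (<⇒≯ (<-trans z<x x<y)) λ { (s≤s ()) }
        ; (suc (suc zero)) zero → both-true z<x ≤-refl
        ; (suc (suc zero)) (suc zero) → both-true (<-trans z<x x<y) (s≤s (s≤s z≤n))
        ; (suc (suc zero)) (suc (suc zero)) → both-false (n≮n _) (n≮n _) }
  ; preserved = λ g (z<x , x<y) → g (here refl) z<x , g (there (here refl)) x<y
  ; reflected = λ g (z<x , x<y) → g z<x , g x<y
  }

describes312 : Describes τ312 Is312
describes312 = record
  { three = refl
  ; iso = mk⇔ (λ (_ , h) → from (h (suc zero) (suc (suc zero))) ≤-refl , from (h (suc (suc zero)) zero) ≤-refl)
      λ (y<z , z<x) → refl , λ
        { zero zero → both-false (n≮n _) (n≮n _)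
        ; zero (suc zero) → both-false (<⇒≯ (<-trans y<z z<x)) λ { (s≤s ()) }
        ; zero (suc (suc zero)) → both-false (<⇒≯ z<x) λ { (s≤s (s≤s ())) }
        ; (suc zero) zero → both-true (<-trans y<z z<x) (s≤s (s≤s z≤n))
        ; (suc zero) (suc zero) → both-false (n≮n _) (n≮n _)
        ; (suc zero) (suc (suc zero)) → both-true y<z ≤-refl
        ; (suc (suc zero)) zero → both-true z<x ≤-refl
        ; (suc (suc zero)) (suc zero) → both-false (<⇒≯ y<z) λ { (s≤s ()) }
        ; (suc (suc zero)) (suc (suc zero)) → both-false (n≮n _) (n≮n _) }
  ; preserved = λ g (y<z , z<x) → g (there (there (here refl))) y<z , g (here refl) z<x
  ; reflected = λ g (y<z , z<x) → g y<z , g z<x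
  }

standardize-contains : ∀ {R} → Describes τ R →
  (standardize xs Contains τ) ⇔ (∃[ x ] ∃[ y ] ∃[ z ] x ∷ y ∷ z ∷ [] ⊆ xs × R x y z)
standardize-contains {τ} {xs} {R} D = mk⇔ fwd bwd
  where
  open Describes D
  fwd : standardize xs Contains τ → ∃[ x ] ∃[ y ] ∃[ z ] x ∷ y ∷ z ∷ [] ⊆ xs × R x y z
  fwd (_ , sub , isom) with ⊆-map⁻ (rank xs) xs sub
  ... | x ∷ y ∷ z ∷ []         , refl , sub′ = x , y , z , sub′ , reflected (rank-cancel-< {xs = xs}) (to iso isom)
  ... | []                     , refl , _ = contradiction (trans (proj₁ isom) three) λ ()
  ... | _ ∷ []                 , refl , _ = contradiction (trans (proj₁ isom) three) λ ()
  ... | _ ∷ _ ∷ []             , refl , _ = contradiction (trans (proj₁ isom) three) λ ()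
  ... | _ ∷ _ ∷ _ ∷ _ ∷ _      , refl , _ = contradiction (trans (proj₁ isom) three) λ ()
  bwd : (∃[ x ] ∃[ y ] ∃[ z ] x ∷ y ∷ z ∷ [] ⊆ xs × R x y z) → standardize xs Contains τ
  bwd (x , y , z , sub , r) = map (rank xs) (x ∷ y ∷ z ∷ []) , map⁺ (rank xs) sub ,
    from iso (preserved (λ v∈ → rank-mono-< (Any-resp-⊆ sub v∈)) r)

place₁ : ∀ (g : ℕ → ℕ) → k < n → g k ∷ [] ⊆ applyUpTo g n
place₁ {zero}  {suc n} g _          = refl ∷ minimum _
place₁ {suc k} {suc n} g (s≤s k<n) = g 0 ∷ʳ place₁ (g ∘ suc) k<n

place₂ : ∀ (g : ℕ → ℕ) → j < k → k < n → g j ∷ g k ∷ [] ⊆ applyUpTo g n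
place₂ {zero}  {suc k} {suc n} g _         (s≤s k<n) = refl ∷ place₁ (g ∘ suc) k<n
place₂ {suc j} {suc k} {suc n} g (s≤s j<k) (s≤s k<n) = g 0 ∷ʳ place₂ (g ∘ suc) j<k k<n

place₃ : ∀ (g : ℕ → ℕ) → i < j → j < k → k < n → g i ∷ g j ∷ g k ∷ [] ⊆ applyUpTo g n
place₃ {zero}  {suc j} {suc k} {suc n} g _         (s≤s j<k) (s≤s k<n) = refl ∷ place₂ (g ∘ suc) j<k k<n
place₃ {suc i} {suc j} {suc k} {suc n} g (s≤s i<j) (s≤s j<k) (s≤s k<n) = g 0 ∷ʳ place₃ (g ∘ suc) i<j j<k k<n

find₁ : ∀ (g : ℕ → ℕ) n → x ∷ [] ⊆ applyUpTo g n → ∃[ k ] k < n × g k ≡ x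
find₁ g (suc n) (refl ∷ _)   = 0 , z<s , refl
find₁ g (suc n) (_ ∷ʳ sub) = let k , k<n , eq = find₁ (g ∘ suc) n sub in suc k , s<s k<n , eq

find₂ : ∀ (g : ℕ → ℕ) n → x ∷ y ∷ [] ⊆ applyUpTo g n → ∃[ j ] ∃[ k ] j < k × k < n × g j ≡ x × g k ≡ y
find₂ g (suc n) (refl ∷ sub) = let k , k<n , eq = find₁ (g ∘ suc) n sub in 0 , suc k , z<s , s<s k<n , refl , eq
find₂ g (suc n) (_ ∷ʳ sub) =
  let j , k , j<k , k<n , eqs = find₂ (g ∘ suc) n sub in suc j , suc k , s<s j<k , s<s k<n , eqs

find₃ : ∀ (g : ℕ → ℕ) n → x ∷ y ∷ z ∷ [] ⊆ applyUpTo g n →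
        ∃[ i ] ∃[ j ] ∃[ k ] i < j × j < k × k < n × g i ≡ x × g j ≡ y × g k ≡ z
find₃ g (suc n) (refl ∷ sub) =
  let j , k , j<k , k<n , eqs = find₂ (g ∘ suc) n sub in 0 , suc j , suc k , z<s , s<s j<k , s<s k<n , refl , eqs
find₃ g (suc n) (_ ∷ʳ sub) =
  let i , j , k , i<j , j<k , k<n , eqs = find₃ (g ∘ suc) n sub in suc i , suc j , suc k , s<s i<j , s<s j<k , s<s k<n , eqs

-- Full placements as permutations

module Placements (F : FerrersBoard) (square : longestRow F ≡ longestColumn F) where
  open Geometry F square

  MarkedBy : RookPlacement F → (ℕ → ℕ) → Set
  MarkedBy P π = ∀ {i j} → (i , j) ∈ markers P ⇔ (i < size × π i ≡ j)

  permutation : (P : RookPlacement F) → IsFull P → ∃₂ λ π ρ → Permutes size columns π ρ × MarkedBy P π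
  permutation P full = π , ρ , record
      { fits = λ i<n → from column (onBoard P _ (π-marks i<n))
      ; ρ<   = λ j<n → inF⇒i<n (onBoard P _ (ρ-marks j<n))
      ; πρ   = λ j<n → colAtMost P (π-marks (inF⇒i<n (onBoard P _ (ρ-marks j<n)))) (ρ-marks j<n)
      ; ρπ   = λ i<n → rowAtMost P (ρ-marks (inF⇒j<n (onBoard P _ (π-marks i<n)))) (π-marks i<n)
      } , mk⇔ (λ p → let i<n = inF⇒i<n (onBoard P _ p) in i<n , colAtMost P (π-marks i<n) p)
              (λ { (i<n , refl) → π-marks i<n })
    where
    π ρ : ℕ → ℕ
    π i with i <? size
    ... | yes i<n = proj₁ (IsFull.eachColumn full i (0 , bottomRow i<n))
    -- A default outside the board; every property of `π` and `ρ` assumes an index below `size`.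
    ... | no  _   = 0
    ρ j with j <? size
    ... | yes j<n = proj₁ (IsFull.eachRow full j (0 , leftColumn j<n))
    ... | no  _   = 0

    π-marks : i < size → (i , π i) ∈ markers P
    π-marks {i} i<n with i <? size
    ... | yes i<n′ = proj₁ (proj₂ (IsFull.eachColumn full i (0 , bottomRow i<n′)))
    ... | no  i≮n  = contradiction i<n i≮n

    ρ-marks : j < size → (ρ j , j) ∈ markers P
    ρ-marks {j} j<n with j <? size
    ... | yes j<n′ = proj₁ (proj₂ (IsFull.eachRow full j (0 , leftColumn j<n′)))
    ... | no  j≮n  = contradiction j<n j≮n

  placement : ∀ {π ρ} → Permutes size columns π ρ → Σ (RookPlacement F) λ P → IsFull P × MarkedBy P π
  placement {π} {ρ} pm = P , full , marked
    where
    open Permutes pm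

    mark : Squares
    mark (i , j) = ⌊ (i <? size) ×-dec (π i ≟ j) ⌋

    marked : ∀ {i j} → (i , j) ∈ mark ⇔ (i < size × π i ≡ j)
    marked = mk⇔ toWitness fromWitness

    P : RookPlacement F
    P = record
      { markers   = mark
      ; onBoard   = λ s p → let i<n , eq = to marked p in to column (subst (_< _) eq (fits i<n))
      ; colAtMost = λ p q → trans (sym (proj₂ (to marked p))) (proj₂ (to marked q))
      ; rowAtMost = λ p q → let i<n , eq = to marked p ; i′<n , eq′ = to marked q in
                    injective i<n i′<n (trans eq (sym eq′))
      }

    full : IsFull P
    full = record
      { eachColumn = λ i (j , p) → π i , from marked (inF⇒i<n p , refl) , λ q → proj₂ (to marked q)
      ; eachRow    = λ j (i , p) → ρ j , from marked (ρ< (inF⇒j<n p) , πρ (inF⇒j<n p)) ,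
                     λ q → let i<n , eq = to marked q in trans (cong ρ (sym eq)) (ρπ i<n)
      }

  module _ (P : RookPlacement F) {π : ℕ → ℕ} (marked : MarkedBy P π) where

    -- A chain exposes its last marker and a list its first, so the markers are moved one at a time
    -- onto an accumulator, here and in the converse.
    chain⇒list : a ≤ size → b ≤ size → Chain π a b l → ∃[ ms ] IsIncreasing P (a , b) ms × length ms ≡ l
    chain⇒list _ _ [] = [] , ([] , []) , refl
    chain⇒list {a} {b} a≤n b≤n (snoc i i<a πi<b ch) =
      let ms , inc , eq = prepend ch [] ((from marked (i<n , refl) , i<a , πi<b) ∷ [] , [-])
      in ms , inc , trans eq (+-comm _ 1)
      where
      i<n = <-≤-trans i<a a≤n
      prepend : ∀ {i l} → Chain π i (π i) l → ∀ ms → IsIncreasing P (a , b) ((i , π i) ∷ ms) →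
                ∃[ ms′ ] IsIncreasing P (a , b) ms′ × length ms′ ≡ l + suc (length ms)
      prepend [] ms inc = _ , inc , refl
      prepend {i} {suc l} (snoc i′ i′<i πi′<πi ch) ms (all@((_ , i<a , πi<b) ∷ _) , linked) =
        let ms′ , inc , eq = prepend ch ((i , π i) ∷ ms)
              ( (from marked (<-≤-trans (<-trans i′<i i<a) a≤n , refl) , <-trans i′<i i<a , <-trans πi′<πi πi<b) ∷ all
              , (i′<i , πi′<πi) ∷ linked )
        in ms′ , inc , trans eq (+-suc l _)

    list⇒chain : ∀ ms → IsIncreasing P (a , b) ms → Chain π a b (length ms)
    list⇒chain [] _ = []
    list⇒chain {a} {b} (s ∷ ms) inc = extend s ms inc []
      where
      extend : ∀ {l} s ms → IsIncreasing P (a , b) (s ∷ ms) → Chain π (proj₁ s) (proj₂ s) l →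
               Chain π a b (suc (l + length ms))
      extend (i , j) [] ((p , i<a , j<b) ∷ [] , _) ch with _ , refl ← to marked p =
        subst (Chain π a b ∘ suc) (sym (+-identityʳ _)) (snoc i i<a j<b ch)
      extend {l} (i , j) (s ∷ ms) ((p , i<a , j<b) ∷ all , (i< , j<) ∷ linked) ch with _ , refl ← to marked p =
        subst (Chain π a b ∘ suc) (sym (+-suc l _)) (extend s ms (all , linked) (snoc i i< j< ch))

    longest⇔ : a ≤ size → b ≤ size → (S⟨ P , (a , b) ⟩≡ l) ⇔ Longest π a b l
    longest⇔ {a} {b} {l} a≤n b≤n = mk⇔
      (λ { ((ms , inc , refl) , max) → list⇒chain ms inc , λ ch →
           let ms′ , inc′ , eq = chain⇒list a≤n b≤n ch in <⇒≱ (≤-reflexive (sym eq)) (max ms′ inc′) })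
      (λ (ch , ¬ch) → chain⇒list a≤n b≤n ch , λ ms inc → chain≤longest (list⇒chain ms inc) (ch , ¬ch))

    sequence⇔ : ∀ S → HasSequence P S ⇔ Realises size columns π (value S)
    sequence⇔ S = mk⇔
      (λ has {a} {b} p → subst (Longest π a b) (value-index S p)
         (to (longest⇔ (a≤n p) (b≤n p)) (subst (λ V → S⟨ P , V ⟩≡ lookup S (index-of p)) (lookup-index p) (has (index-of p)))))
      (λ real k → let V = lookup (border F) k ; p = At.border-vertex (at-border k) in
         from (longest⇔ (a≤n p) (b≤n p)) (subst (Longest π (proj₁ V) (proj₂ V)) (value-border S k) (real p)))

    restriction-word : a ≤ size → ∀ b → restriction P (a , b) ≡ filter (_<? b) (applyUpTo π a)
    restriction-word {a} a≤n b = go a id λ i<a → <-≤-trans i<a a≤n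
      where
      go : ∀ a g → (∀ {i} → i < a → g i < size) →
           concatMap (λ i → filterᵇ (λ j → markers P (i , j)) (upTo b)) (applyUpTo g a) ≡
           filter (_<? b) (applyUpTo (π ∘ g) a)
      go zero    g g<n = refl
      go (suc a) g g<n = trans
        (cong₂ _++_ (filterᵇ-singleton (λ j → markers P (g 0 , j)) b
                      (mk⇔ (proj₂ ∘ to marked) λ eq → from marked (g<n z<s , eq)))
                    (go a (g ∘ suc) (g<n ∘ s<s)))
        (sym (filter-++ (_<? b) (π (g 0) ∷ []) (applyUpTo (π ∘ g ∘ suc) a)))

    Free : Ternary → Set
    Free R = ∀ {a b i j k} → Border a b → i < j → j < k → k < a →
             π i < b → π j < b → π k < b → ¬ R (π i) (π j) (π k)

    avoids⇔ : ∀ {τ R} → Describes τ R → Avoids P τ ⇔ Free R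
    avoids⇔ {τ} {R} D = mk⇔ fwd bwd
      where
      fwd : Avoids P τ → Free R
      fwd avoids {a} {b} {i} {j} {k} p i<j j<k k<a πi<b πj<b πk<b r =
        avoids (index-of p) (subst (λ V → standardize (restriction P V) Contains τ) (sym (lookup-index p))
          (subst (λ w → standardize w Contains τ) (sym (restriction-word (a≤n p) b))
            (from (standardize-contains D) (_ , _ , _ ,
              subst (_⊆ filter (_<? b) (applyUpTo π a)) (filter-all (_<? b) (πi<b ∷ πj<b ∷ πk<b ∷ []))
                (filter⁺ (_<? b) (_<? b) (λ { refl lt → lt }) (place₃ π i<j j<k k<a)) , r))))
      at-vertex : Free R → Border a b → ¬ (standardize (restriction P (a , b)) Contains τ)
      at-vertex {a} {b} free p contains
        with x , y , z , sub , r ← to (standardize-contains D)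
               (subst (λ w → standardize w Contains τ) (restriction-word (a≤n p) b) contains)
        with πi<b ∷ πj<b ∷ πk<b ∷ [] ← All-resp-⊆ sub (all-filter (_<? b) (applyUpTo π a))
        with i , j , k , i<j , j<k , k<a , refl , refl , refl ← find₃ π _ (⊆-trans sub (filter-⊆ (_<? b) (applyUpTo π a)))
        = free p i<j j<k k<a πi<b πj<b πk<b r

      bwd : Free R → Avoids P τ
      bwd free k = at-vertex free (At.border-vertex (at-border k))

    -- At the top right corner of column `k` the rectangle is as high as any border rectangle that
    -- reaches this column, so patterns whose last marker is in column `k` are tested there.
    corner : k < size → Border (suc k) (columns (suc k))
    corner k<n = onBorder k<n ≤-refl (Shape.anti (Diagram.shape columnDiagram) (n≤1+n _))

    free231⇔ : Free Is231 ⇔ No231 size columns π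
    free231⇔ = mk⇔ fwd bwd
      where
      fwd : Free Is231 → No231 size columns π
      fwd free {k = k} i<j j<k k<n πk<πi πi<πj = ≮⇒≥ λ πj<H →
        free (corner k<n) i<j j<k (n<1+n k) (<-trans πi<πj πj<H) πj<H (<-trans πk<πi (<-trans πi<πj πj<H)) (πk<πi , πi<πj)

      bwd : No231 size columns π → Free Is231
      bwd av p i<j j<k k<a πi<b πj<b πk<b (πk<πi , πi<πj) = <⇒≱ πj<b
        (≤-trans (below p) (≤-trans (Shape.anti (Diagram.shape columnDiagram) k<a (a≤n p))
          (av i<j j<k (<-≤-trans k<a (a≤n p)) πk<πi πi<πj)))

    -- A 312 in columns `i`, `j`, `k`, read by rows from the bottom, lists the columns `j`, `k`,
    -- `i`, which is a 231 of the inverse. On either board the three markers share a rectangle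
    -- exactly when the square in column `k` and in the row of the marker of `i` belongs to it.
    free312⇔ : ∀ {ρ} → Permutes size columns π ρ → Free Is312 ⇔ No231 size rows ρ
    free312⇔ {ρ} pm = mk⇔ fwd bwd
      where
      open Permutes pm

      fwd : Free Is312 → No231 size rows ρ
      fwd free {i} {j} {k} i<j j<k k<n ρk<ρi ρi<ρj = ≮⇒≥ λ ρj<K →
        let k<H = from column (to row ρj<K) in
        free (corner (ρ< j<n)) ρk<ρi ρi<ρj (n<1+n (ρ j))
          (subst (_< _) (sym (πρ k<n)) k<H)
          (subst (_< _) (sym (πρ i<n)) (<-trans i<j (<-trans j<k k<H)))
          (subst (_< _) (sym (πρ j<n)) (<-trans j<k k<H))
          (subst₂ _<_ (sym (πρ i<n)) (sym (πρ j<n)) i<j , subst₂ _<_ (sym (πρ j<n)) (sym (πρ k<n)) j<k)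
        where
        j<n = <-trans j<k k<n
        i<n = <-trans i<j j<n

      bwd : No231 size rows ρ → Free Is312
      bwd av {i = i} p i<j j<k k<a πi<b πj<b πk<b (πj<πk , πk<πi) =
        <⇒≱ (from row (to column (<-≤-trans πi<b (≤-trans (below p) (Shape.anti (Diagram.shape columnDiagram) k<a (a≤n p))))))
          (subst (rowLength F (π i) ≤_) (ρπ k<n)
            (av πj<πk πk<πi (<-≤-trans πi<b (b≤n p))
              (subst₂ _<_ (sym (ρπ i<n)) (sym (ρπ j<n)) i<j) (subst₂ _<_ (sym (ρπ j<n)) (sym (ρπ k<n)) j<k)))
        where
        k<n = <-≤-trans k<a (a≤n p)
        j<n = <-trans j<k k<n
        i<n = <-trans i<j j<n

-- The equivalence for 231, and for 312 by reflection.

theorem2 : (F : FerrersBoard) → longestRow F ≡ longestColumn F →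
    (S : FSequence F) →
    ((Σ (RookPlacement F) λ P → P ∈S[ τ231 ] × HasSequence P S) ⇔ Conditions231 F S)
    × ((Σ (RookPlacement F) λ P → P ∈S[ τ312 ] × HasSequence P S) ⇔ Conditions312 F S)
theorem2 F square S = mk⇔ necessary231 sufficient231 , mk⇔ necessary312 sufficient312
  where
  open Geometry F square
  open Placements F square

  necessary231 : (Σ (RookPlacement F) λ P → P ∈S[ τ231 ] × HasSequence P S) → Conditions231 F S
  necessary231 (P , (full , avoids) , has) =
    let π , ρ , pm , marked = permutation P full
        no231 = to (free231⇔ P marked) (to (avoids⇔ P marked describes231) avoids)
    in concretely S _≤_ (conditions-map id (from column)
         (Necessity.conditions (Diagram.shape columnDiagram) pm no231 (to (sequence⇔ P marked S) has)))

  sufficient231 : Conditions231 F S → Σ (RookPlacement F) λ P → P ∈S[ τ231 ] × HasSequence P S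
  sufficient231 conds =
    let open Realisation (realisable size (Diagram.shape columnDiagram)
               (conditions-map id (to column) (abstractly S _≤_ conds)))
        P , full , marked = placement permutes
    in P , (full , from (avoids⇔ P marked describes231) (from (free231⇔ P marked) no231))
         , from (sequence⇔ P marked S) realises

  necessary312 : (Σ (RookPlacement F) λ P → P ∈S[ τ312 ] × HasSequence P S) → Conditions312 F S
  necessary312 (P , (full , avoids) , has) =
    let π , ρ , pm , marked = permutation P full
        no231 = to (free312⇔ P marked pm) (to (avoids⇔ P marked describes312) avoids)
        pm′   = permutes-transpose columnDiagram rowDiagram pm
        real′ = realises-transpose columnDiagram rowDiagram pm (to (sequence⇔ P marked S) has)
    in concretely S _≥_ (conditions-transpose
         (conditions-map (onBorder-transpose columnDiagram rowDiagram) (from row)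
           (Necessity.conditions (Diagram.shape rowDiagram) pm′ no231 real′)))

  sufficient312 : Conditions312 F S → Σ (RookPlacement F) λ P → P ∈S[ τ312 ] × HasSequence P S
  sufficient312 conds =
    let open Realisation (realisable size (Diagram.shape rowDiagram)
               (conditions-map (onBorder-transpose rowDiagram columnDiagram) (to row)
                 (conditions-transpose (abstractly S _≥_ conds))))
        pm = permutes-transpose rowDiagram columnDiagram permutes
        P , full , marked = placement pm
    in P , (full , from (avoids⇔ P marked describes312) (from (free312⇔ P marked pm) no231))
         , from (sequence⇔ P marked S) (realises-transpose rowDiagram columnDiagram permutes realises)
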